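{- Let $s\ge 1$ and let $S=\{x^2+c_1, x^2+c_2,\dots,x^2+c_s\}$ for some pairwise distinct $c_1,\dots,c_s\in\mathbb{Q}$. Suppose that $\mu_S(\mathbb{Q})\le 3$, i.e. no polynomial in $S$ has a point of $\mathbb{P}^1(\mathbb{Q})$ of exact period greater than $3$. Then: (1) If $\#S=3$ and $P\in\mathbb{Q}$ has finite orbit for $S$, then either $S=\{x^2-\tfrac{5}{16},\ x^2-\tfrac{13}{16},\ x^2-\tfrac{21}{16}\}$ and $P\in\{\pm\tfrac14,\pm\tfrac34,\pm\tfrac54\}$, or $S=\{x^2+\tfrac{3}{16},\ x^2-\tfrac{5}{16},\ x^2-\tfrac{13}{16}\}$ and $P\in\{\pm\tfrac14,\pm\tfrac34\}$. (2) If $\#S\ge 4$, then there is no point $P\in\mathbb{Q}$ with finite orbit for $S$.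
   Context: For a finite set $S$ of rational functions over $\mathbb{Q}$, let $M_S$ be the monoid of all finite compositions $\phi_n\circ\cdots\circ\phi_1$ ($n\ge1$, $\phi_i\in S$). The orbit of $P\in\mathbb{P}^1(\mathbb{Q})$ for $S$ is $\mathrm{Orb}_S(P)=\{\rho(P):\rho\in M_S\}$, and $P$ has finite orbit for $S$ if this set is finite. A point $P$ has exact period $n$ for $\phi$ if $\phi^n(P)=P$ and $\phi^m(P)\ne P$ for $0<m<n$. The quantity $\mu_S(\mathbb{Q})$ is the supremum of all $n$ such that some $\phi\in S$ has a point of $\mathbb{P}^1(\mathbb{Q})$ of exact period $n$. -}

module Defs where

open import Data.Nat using (ℕ; zero; suc; _<_; _≤_)
open import Data.Integer using (ℤ; +_)
open import Data.Rational using (ℚ; _+_; _*_; _/_; -_)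
open import Data.List using (List; []; _∷_)
open import Data.List.Relation.Unary.All using (All)
open import Data.List.Membership.Propositional using (_∈_)
open import Data.Product using (Σ; _×_)
open import Relation.Binary.PropositionalEquality using (_≡_; _≢_)

quad : ℚ → ℚ → ℚ
quad c x = x * x + c

iter : (ℚ → ℚ) → ℕ → ℚ → ℚ
iter f zero x = x
iter f (suc n) x = iter f n (f x)

ExactPeriod : (ℚ → ℚ) → ℕ → ℚ → Set
ExactPeriod f n x = (0 < n) × (iter f n x ≡ x) × (∀ m → 0 < m → m < n → iter f m x ≢ x)

-- μ_S(ℚ) ≤ 3 for S = {x² + c : c ∈ cs}.  (The point ∞ is fixed by every
-- polynomial, so only finite rational points need to be considered.)
MuAtMost3 : List ℚ → Set
MuAtMost3 cs = ∀ c → c ∈ cs → ∀ (x : ℚ) (n : ℕ) → ExactPeriod (quad c) n x → n ≤ 3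

applyWord : List ℚ → ℚ → ℚ
applyWord [] x = x
applyWord (c ∷ w) x = applyWord w (quad c x)

InOrbit : List ℚ → ℚ → ℚ → Set
InOrbit cs P y = Σ (List ℚ) λ w → (w ≢ []) × All (_∈ cs) w × (applyWord w P ≡ y)

FiniteOrbit : List ℚ → ℚ → Set
FiniteOrbit cs P = Σ (List ℚ) λ L → ∀ y → InOrbit cs P y → y ∈ L

SameSet : List ℚ → List ℚ → Set
SameSet A B = ∀ c → (c ∈ A → c ∈ B) × (c ∈ B → c ∈ A)

-- {c : S = {x² + c}} for the two exceptional families, and the point sets
S₁ : List ℚ
S₁ = - (+ 5 / 16) ∷ - (+ 13 / 16) ∷ - (+ 21 / 16) ∷ []

P₁ : List ℚ
P₁ = + 1 / 4 ∷ - (+ 1 / 4) ∷ + 3 / 4 ∷ - (+ 3 / 4) ∷ + 5 / 4 ∷ - (+ 5 / 4) ∷ []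

S₂ : List ℚ
S₂ = + 3 / 16 ∷ - (+ 5 / 16) ∷ - (+ 13 / 16) ∷ []

P₂ : List ℚ
P₂ = + 1 / 4 ∷ - (+ 1 / 4) ∷ + 3 / 4 ∷ - (+ 3 / 4) ∷ []

{-# OPTIONS --safe #-}
module Submission where

-- A finite orbit yields a finite stable set L of rationals containing P.  Scaled by its least common
-- denominator N, it becomes a set of integers u coprime to N on which each x² + c acts as
-- u ↦ (u² + N² c)/N; in particular N divides all differences u² - v².  The values of two of the maps
-- at one point differ by a constant d = N (c′ - c).  Divisibility by the greatest common divisor of
-- all differences u² - v², which each map expands unless w + z shares a factor with N, gives N ∣ 2d:
-- the c's differ by half-integers.  If m and U are the extreme absolute values, then the three values
-- at m and at U have to fit into ±[m , U], and this is impossible unless the three constants are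
-- c, c + 1/2, c + 1.  In that case N = 4 and U ≤ 5, and the points are ±1, ±3, ±5 over 4.
-- Of four constants, two would have to equal c + 1.

open import Defs
open import Data.Nat using (_≤_)
open import Data.Rational using (ℚ)
open import Data.List using (List; length)
open import Data.List.Relation.Unary.Unique.Propositional using (Unique)
open import Data.List.Membership.Propositional using (_∈_)
open import Data.Product using (_×_)
open import Data.Sum using (_⊎_)
open import Relation.Nullary using (¬_)
open import Relation.Binary.PropositionalEquality using (_≡_)

open import Relation.Binary.Bundles using (DecTotalOrder)
import Data.Nat as ℕ
import Data.Nat.Properties as ℕ
import Data.Nat.Divisibility as ℕ
import Data.Nat.DivMod as ℕ
import Data.Nat.GCD as ℕ
import Data.Nat.Coprimality as ℕ
open import Data.Nat using (ℕ; suc; NonZero; NonTrivial; s≤s)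
open import Data.Nat.LCM using (lcm; m∣lcm[m,n]; n∣lcm[m,n]; lcm-least; gcd*lcm)
open import Data.Nat.Coprimality using (Coprime; 1-coprimeTo)
open import Data.Nat.Primality using (Prime; euclidsLemma; prime⇒nonTrivial)
open import Data.Nat.Primality.Factorisation using (factorise)
open import Data.Integer using (ℤ; +_; -[1+_]; _+_; _*_; _-_; -_; ∣_∣; 0ℤ; +≤+; nonNegative; ≢-nonZero)
  renaming (_≤_ to _≤ᶻ_)
open import Data.Integer.Properties using
  ( *-cancelˡ-≡; *-zeroʳ; *-comm; *-identityʳ; abs-*; pos-*; i-j≡0⇒i≡j; +∣i∣≡i⊎+∣i∣≡-i
  ; +-mono-≤; *-monoˡ-≤-nonNeg; ≤-antisym; i≤j⇒0≤j-i; 0≤i-j⇒j≤i )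
open import Data.Integer.Divisibility.Signed using
  (_∣_; divides; ∣ᵤ⇒∣; ∣⇒∣ᵤ; ∣-trans; ∣m∣n⇒∣m-n; ∣m⇒∣m*n)
open import Data.Integer.GCD using (gcd; gcd[i,j]∣i; gcd[i,j]∣j)
open import Data.Integer.Tactic.RingSolver using (solve; solve-∀)
open import Data.Rational using (mkℚ; 1ℚ; ↥_; ↧_; ↧ₙ_)
import Data.Rational as ℚ
import Data.Rational.Properties as ℚ
import Data.Rational.Unnormalised as ℚᵘ
import Data.Rational.Unnormalised.Properties as ℚᵘ
import Data.Rational.Solver as ℚ
open import Algebra.Properties.Group ℚ.+-0-group using (∙-cancelˡ)
open import Data.List using ([]; _∷_; _++_; map; filter)
open import Data.List.Extrema.Nat using (argmin; argmax; argmin-sel; argmax-sel; f[argmin]≤f[xs]; f[xs]≤f[argmax])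
open import Data.List.Properties using (filter-notAll)
open import Data.List.Membership.Propositional.Properties using (∈-map⁺; ∈-map⁻; ∈-filter⁺)
open import Data.List.Membership.DecPropositional ℚ._≟_ using (_∈?_)
open import Data.List.Relation.Unary.Any using (here; there)
open import Data.List.Relation.Unary.All using (All)
import Data.List.Relation.Unary.All as All
open import Data.List.Relation.Unary.All.Properties using (¬All⇒Any¬; ++⁺)
open import Data.List.Relation.Binary.Permutation.Propositional using (_↭_; ↭-sym; ↭⇒↭ₛ)
open import Data.List.Relation.Binary.Permutation.Propositional.Properties using (∈-resp-↭; ↭-length)
import Data.List.Relation.Binary.Permutation.Setoid.Properties as Permutation
open import Data.List.Relation.Unary.Sorted.TotalOrder (DecTotalOrder.totalOrder ℚ.≤-decTotalOrder) using (Sorted)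
open import Data.List.Sort ℚ.≤-decTotalOrder using (sort; sort-↭; sort-↗)
open import Data.Product using (∃; _,_; proj₁; proj₂)
open import Data.Sum using (inj₁; inj₂; [_,_]′)
open import Data.Empty using (⊥; ⊥-elim)
open import Relation.Nullary using (Dec; yes; no)
open import Relation.Binary.PropositionalEquality using (_≢_; refl; sym; trans; cong; cong₂; subst; subst₂; setoid; module ≡-Reasoning)

-- Equations and cancellation over the integers.

-- Equations are derived as linear combinations of hypotheses, which leaves a polynomial identity
-- for the ring solver.
combination₁ : ∀ {x y p q} c → p ≡ q → x - y ≡ c * (p - q) → x ≡ y
combination₁ {x} {y} {p} c refl e = i-j≡0⇒i≡j x y (trans e (vanish c p))
  where
  vanish : ∀ c p → c * (p - p) ≡ 0ℤ
  vanish = solve-∀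

combination₂ : ∀ {x y p q r s} c d → p ≡ q → r ≡ s → x - y ≡ c * (p - q) + d * (r - s) → x ≡ y
combination₂ {x} {y} {p} {r = r} c d refl refl e = i-j≡0⇒i≡j x y (trans e (vanish c d p r))
  where
  vanish : ∀ c d p r → c * (p - p) + d * (r - r) ≡ 0ℤ
  vanish = solve-∀

combination₃ : ∀ {x y p q r s t u} c d e → p ≡ q → r ≡ s → t ≡ u →
  x - y ≡ c * (p - q) + d * (r - s) + e * (t - u) → x ≡ y
combination₃ {x} {y} {p} {r = r} {t = t} c d e refl refl refl h = i-j≡0⇒i≡j x y (trans h (vanish c d e p r t))
  where
  vanish : ∀ c d e p r t → c * (p - p) + d * (r - r) + e * (t - t) ≡ 0ℤ
  vanish = solve-∀

cancelˡ : ∀ {n x y} → n ≢ 0ℤ → n * x ≡ n * y → x ≡ y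
cancelˡ {n} {x} {y} n≢0 = *-cancelˡ-≡ n x y {{≢-nonZero n≢0}}

∣-cancelʳ : ∀ {n x g} → g ≢ 0ℤ → n * g ∣ x * g → n ∣ x
∣-cancelʳ {n} {x} {g} g≢0 (divides q e) =
  divides q (cancelˡ g≢0 (combination₁ (+ 1) e (solve (n ∷ x ∷ g ∷ q ∷ []))))

-- Parity.

Even Odd : ℤ → Set
Even x = ∃ λ q → x ≡ + 2 * q
Odd x = ∃ λ q → x ≡ + 2 * q + + 1

parity-suc : ∀ {x} → Even x ⊎ Odd x → Even (+ 1 + x) ⊎ Odd (+ 1 + x)
parity-suc (inj₁ (q , refl)) = inj₂ (q , solve (q ∷ []))
parity-suc (inj₂ (q , refl)) = inj₁ (q + + 1 , solve (q ∷ []))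

parity-neg : ∀ {x} → Even x ⊎ Odd x → Even (- x) ⊎ Odd (- x)
parity-neg (inj₁ (q , refl)) = inj₁ (- q , solve (q ∷ []))
parity-neg (inj₂ (q , refl)) = inj₂ (- q - + 1 , solve (q ∷ []))

parity : ∀ x → Even x ⊎ Odd x
parity (+ n) = from-ℕ n
  where
  from-ℕ : ∀ n → Even (+ n) ⊎ Odd (+ n)
  from-ℕ 0 = inj₁ (0ℤ , refl)
  from-ℕ (suc n) = parity-suc (from-ℕ n)
parity -[1+ n ] = parity-neg (parity (+ suc n))

1≢2* : ∀ q → + 1 ≢ + 2 * q
1≢2* q e with ℕ.∣1⇒≡1 (∣⇒∣ᵤ (divides {+ 2} {+ 1} q (trans e (*-comm (+ 2) q))))
... | ()

even∧odd⇒⊥ : ∀ {x} → Even x → Odd x → ⊥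
even∧odd⇒⊥ (q , refl) (r , e) = 1≢2* (q - r) (combination₁ (- + 1) e (solve (q ∷ r ∷ [])))

odd*even⇒even : ∀ {x y z} → Odd x → x * y ≡ + 2 * z → Even y
odd*even⇒even {x} {y} {z} (q , refl) e = z - q * y , combination₁ (+ 1) e (solve (q ∷ y ∷ z ∷ []))

odd-odd⇒even : ∀ {x y} → Odd x → Odd y → Even (x - y)
odd-odd⇒even (q , refl) (r , refl) = q - r , solve (q ∷ r ∷ [])

-- The greatest common divisor of the square differences.

gcd-linear : ∀ g e i j → g ∣ e * i → g ∣ e * j → g ∣ e * gcd i j
gcd-linear g e i j p q = ∣ᵤ⇒∣ (subst (∣ g ∣ ℕ.∣_) eq (ℕ.gcd-greatest (unsigned p) (unsigned q)))
  where
  unsigned : ∀ {x} → g ∣ e * x → ∣ g ∣ ℕ.∣ ∣ e ∣ ℕ.* ∣ x ∣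
  unsigned {x} p = subst (∣ g ∣ ℕ.∣_) (abs-* e x) (∣⇒∣ᵤ p)
  eq : ℕ.gcd (∣ e ∣ ℕ.* ∣ i ∣) (∣ e ∣ ℕ.* ∣ j ∣) ≡ ∣ e * gcd i j ∣
  eq = trans (sym (ℕ.c*gcd[m,n]≡gcd[cm,cn] (∣ e ∣) (∣ i ∣) (∣ j ∣))) (sym (abs-* e (gcd i j)))

-- The second clause is the universal property after multiplication by any `e`; this is the form in
-- which divisibility of all multiples `e * x` passes to `e * G`. The value `G = 0` is allowed and
-- has to be excluded later.
IsGCD : (ℤ → Set) → ℤ → Set
IsGCD P G = (∀ {x} → P x → G ∣ x) × (∀ g e → (∀ {x} → P x → g ∣ e * x) → g ∣ e * G)

gcd-list : ∀ xs → ∃ (IsGCD (_∈ xs))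
gcd-list [] = 0ℤ , (λ ()) , λ g e _ → divides 0ℤ (*-zeroʳ e)
gcd-list (x ∷ xs) with gcd-list xs
... | G , G∣ , linear = gcd x G , divide , λ g e h → gcd-linear g e x G (h (here refl)) (linear g e (λ i → h (there i)))
  where
  divide : ∀ {y} → y ∈ x ∷ xs → gcd x G ∣ y
  divide (here refl) = ∣ᵤ⇒∣ (gcd[i,j]∣i x G)
  divide (there i) = ∣-trans (∣ᵤ⇒∣ (gcd[i,j]∣j x G)) (G∣ i)

SquareDifference : List ℤ → ℤ → Set
SquareDifference us x = ∃ λ u → ∃ λ v → u ∈ us × v ∈ us × x ≡ u * u - v * v

-- Differences with one fixed square `b * b` suffice: every other square difference is a difference
-- of two of these, so the gcd of a finite list serves.
gcd-squareDifferences : ∀ {us u} → u ∈ us → ∃ (IsGCD (SquareDifference us))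
gcd-squareDifferences {us} {b} b∈ with gcd-list (map (λ u → u * u - b * b) us)
... | G , G∣ , linear = G , divide , λ g e h → linear g e (λ i → listed g e h i)
  where
  divide : ∀ {x} → SquareDifference us x → G ∣ x
  divide (u , v , u∈ , v∈ , refl) = subst (G ∣_) (telescope u v b) (∣m∣n⇒∣m-n (G∣ (∈-map⁺ _ u∈)) (G∣ (∈-map⁺ _ v∈)))
    where
    telescope : ∀ u v b → (u * u - b * b) - (v * v - b * b) ≡ u * u - v * v
    telescope = solve-∀
  listed : ∀ g e → (∀ {x} → SquareDifference us x → g ∣ e * x) → ∀ {x} → x ∈ map (λ u → u * u - b * b) us → g ∣ e * x
  listed g e h i with ∈-map⁻ _ i
  ... | u , u∈ , refl = h (u , b , u∈ , b∈ , refl)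

-- Closed sets of integers, and the divisibility of `2d` by `N`.

-- In the coordinate u = N x the map x ↦ x² + c becomes u ↦ (u² + a)/N with a = N² c.
_Closed_ : ℤ × ℤ → List ℤ → Set
(N , a) Closed us = ∀ {u} → u ∈ us → ∃ λ w → w ∈ us × N * w ≡ u * u + a

image-difference : ∀ {N a} u v w z → N * w ≡ u * u + a → N * z ≡ v * v + a → u * u - v * v ≡ (w - z) * N
image-difference {N} {a} u v w z w≡ z≡ = combination₂ (- + 1) (+ 1) w≡ z≡ (solve (N ∷ a ∷ u ∷ v ∷ w ∷ z ∷ []))

Triple : List ℤ → ℤ → ℤ → ℤ → Set
Triple us d e w = w ∈ us × w + d ∈ us × w + d + e ∈ us

squareDifference-divisible : ∀ {N a us u v} → (N , a) Closed us → u ∈ us → v ∈ us → N ∣ u * u - v * v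
squareDifference-divisible {N} {u = u} {v} closed u∈ v∈ =
  let w , _ , w≡ = closed u∈
      z , _ , z≡ = closed v∈
  in divides (w - z) (image-difference {N} u v w z w≡ z≡)

module _ {N : ℤ} {us : List ℤ} (N≢0 : N ≢ 0ℤ) (coprime : ∀ {u} → u ∈ us → ∀ {x} → N ∣ u * x → N ∣ x) where

  translate : ∀ {a b d u w} → b ≡ a + N * d → (N , b) Closed us → u ∈ us → N * w ≡ u * u + a → w + d ∈ us
  translate {a} {b} {d} {u} {w} b≡ closed u∈ w≡ = let _ , z∈ , z≡ = closed u∈ in subst (_∈ us) (unique z≡) z∈
    where
    unique : ∀ {z} → N * z ≡ u * u + b → z ≡ w + d
    unique {z} z≡ = cancelˡ N≢0 (combination₃ (+ 1) (- + 1) (+ 1) z≡ w≡ b≡ (solve (N ∷ a ∷ b ∷ u ∷ w ∷ d ∷ z ∷ [])))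

  -- If `u = 2q` and `N = 2n`, then `N` divides `u * n = q * N`, so by coprimality `N` would divide
  -- its own half `n`.
  even⇒odd : ∀ {n u} → N ≡ + 2 * n → u ∈ us → Odd u
  even⇒odd {n} {u} N≡ u∈ = [ (λ (q , u≡) → ⊥-elim (not-even u≡)) , (λ o → o) ]′ (parity u)
    where
    cofactor : ∀ {q} → u ≡ + 2 * q → u * n ≡ q * N
    cofactor {q} u≡ = combination₂ n (- q) u≡ N≡ (solve (q ∷ n ∷ u ∷ N ∷ []))
    n≢0 : n ≢ 0ℤ
    n≢0 n≡0 = N≢0 (trans N≡ (cong (λ z → + 2 * z) n≡0))
    no-inverse : ∀ {r} → n ≢ r * N
    no-inverse {r} r≡ = 1≢2* r (cancelˡ n≢0 (combination₂ (+ 1) r r≡ N≡ (solve (r ∷ n ∷ N ∷ []))))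
    not-even : ∀ {q} → u ≢ + 2 * q
    not-even {q} u≡ = let divides r r≡ = coprime u∈ (divides q (cofactor {q} u≡)) in no-inverse {r} r≡

  module _ {a b d} (b≡ : b ≡ a + N * d) (closedᵃ : (N , a) Closed us) (closedᵇ : (N , b) Closed us)
           {G} (isGCD : IsGCD (SquareDifference us) G) (G≢0 : G ≢ 0ℤ) where

    private
      G∣ : ∀ {u v} → u ∈ us → v ∈ us → G ∣ u * u - v * v
      G∣ {u} {v} u∈ v∈ = proj₁ isGCD (u , v , u∈ , v∈ , refl)

    -- The map u ↦ (u² + a)/N takes the square difference k G of u and v to j G, where N j = k (w + z):
    -- a prime of N not dividing w + z would divide every k, contrary to the choice of G.
    quotient-step : ∀ u v w z k j → N * w ≡ u * u + a → N * z ≡ v * v + a →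
      u * u - v * v ≡ k * G → w * w - z * z ≡ j * G → k * (w + z) ≡ N * j
    quotient-step u v w z k j w≡ z≡ k≡ j≡ =
      cancelˡ G≢0 (combination₃ (- (w + z)) N (w + z) k≡ j≡ (image-difference {N} u v w z w≡ z≡)
        (solve (N ∷ G ∷ k ∷ j ∷ u ∷ v ∷ w ∷ z ∷ [])))

    -- `N` divides `(w + d)² - w²` and `(z + d)² - z²`, hence their difference `2d(w - z)`; by
    -- `quotient-step` it also divides `2dk(w + z)`. Together `N` divides `4dkw`, and `w` cancels.
    -- So `N * G` divides `4d` times each square difference `k * G`, hence `4d * G`.
    N∣4d : N ∣ + 4 * d
    N∣4d = ∣-cancelʳ G≢0 (proj₂ isGCD (N * G) (+ 4 * d) λ { (_ , _ , u∈ , v∈ , refl) → multiple u∈ v∈ })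
      where
      cofactor : ∀ w z k j α β → (w + d) * (w + d) - w * w ≡ α * N → (z + d) * (z + d) - z * z ≡ β * N →
        k * (w + z) ≡ N * j → w * (+ 4 * k * d) ≡ (k * (α - β) + + 2 * d * j) * N
      cofactor w z k j α β α≡ β≡ s = combination₃ k (- k) (+ 2 * d) α≡ β≡ s
        (solve (N ∷ k ∷ d ∷ w ∷ z ∷ α ∷ β ∷ j ∷ []))
      scale : ∀ x k r → x ≡ k * G → + 4 * k * d ≡ r * N → + 4 * d * x ≡ r * (N * G)
      scale x k r k≡ r≡ = combination₂ (+ 4 * d) G k≡ r≡ (solve (N ∷ G ∷ k ∷ d ∷ x ∷ r ∷ []))
      multiple : ∀ {u v} → u ∈ us → v ∈ us → N * G ∣ + 4 * d * (u * u - v * v)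
      multiple {u} {v} u∈ v∈ =
        let w , w∈ , w≡ = closedᵃ u∈
            z , z∈ , z≡ = closedᵃ v∈
            divides k k≡ = G∣ u∈ v∈
            divides j j≡ = G∣ w∈ z∈
            divides α α≡ = squareDifference-divisible {N} {a} {us} closedᵃ (translate b≡ closedᵇ u∈ w≡) w∈
            divides β β≡ = squareDifference-divisible {N} {a} {us} closedᵃ (translate b≡ closedᵇ v∈ z≡) z∈
            divides r r≡ = coprime w∈ {+ 4 * k * d} (divides (k * (α - β) + + 2 * d * j)
                             (cofactor w z k j α β α≡ β≡ (quotient-step u v w z k j w≡ z≡ k≡ j≡)))
        in divides r (scale (u * u - v * v) k r k≡ r≡)

    -- If N ∣ 4d but N ∤ 2d, then N = 8n and d = 2nt with t odd, and all values w of one map lie in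
    -- one odd class mod 4; so w + z is twice an odd number and quotient-step gives 4 ∣ k for all pairs.
    8∤N : ∀ {n t} → N ≡ + 8 * n → d ≡ + 2 * n * t → ¬ Odd t
    8∤N {n} {t} N≡ d≡ t-odd =
      4G∤G (proj₂ isGCD (+ 4 * G) (+ 1) λ { (_ , _ , u∈ , v∈ , refl) → multiple u∈ v∈ })
      where
      n≢0 : n ≢ 0ℤ
      n≢0 n≡0 = N≢0 (trans N≡ (cong (λ z → + 8 * z) n≡0))
      us-odd : ∀ {u} → u ∈ us → Odd u
      us-odd = even⇒odd {+ 4 * n} (trans N≡ (solve (n ∷ [])))
      cancel-odd : ∀ {x y z} → Odd x → x * y ≡ + 4 * z → ∃ λ r → y ≡ + 4 * r
      cancel-odd {x} {y} {z} o e =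
        let q , y≡ = odd*even⇒even o (trans e (regroup z))
            r , q≡ = odd*even⇒even o (halve y≡)
        in r , double y≡ q≡
        where
        regroup : ∀ z → + 4 * z ≡ + 2 * (+ 2 * z)
        regroup = solve-∀
        halve : ∀ {q} → y ≡ + 2 * q → x * q ≡ + 2 * z
        halve {q} y≡ = cancelˡ {+ 2} (λ ()) (combination₂ (+ 1) (- x) e y≡ (solve (x ∷ y ∷ q ∷ z ∷ [])))
        double : ∀ {q r} → y ≡ + 2 * q → q ≡ + 2 * r → y ≡ + 4 * r
        double {q} {r} y≡ q≡ = combination₂ (+ 1) (+ 2) y≡ q≡ (solve (y ∷ q ∷ r ∷ []))
      -- The images `p` and `q` of `w` and `w + d` satisfy `8n(q - p) = 4nt(w + nt)`. As `q - p` is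
      -- even, 4 divides `t(w + nt)`, where `t` is odd.
      class-mod-4 : ∀ {w} → w ∈ us → w + d ∈ us → ∃ λ y → w + n * t ≡ + 4 * y
      class-mod-4 {w} w∈ w+d∈ =
        let p , p∈ , p≡ = closedᵃ w∈
            q , q∈ , q≡ = closedᵃ w+d∈
            r , r≡ = odd-odd⇒even (us-odd q∈) (us-odd p∈)
        in cancel-odd {z = r} t-odd (cancelˡ n≢0 (cancelˡ {+ 4} (λ ()) (reduced p q r N≡ d≡ p≡ q≡ r≡)))
        where
        reduced : ∀ p q r {N d} → N ≡ + 8 * n → d ≡ + 2 * n * t →
          N * p ≡ w * w + a → N * q ≡ (w + d) * (w + d) + a → q - p ≡ + 2 * r →
          + 4 * (n * (t * (w + n * t))) ≡ + 4 * (n * (+ 4 * r))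
        reduced p q r refl refl p≡ q≡ r≡ = combination₃ (+ 1) (- + 1) (+ 8 * n) p≡ q≡ r≡
          (solve (n ∷ t ∷ w ∷ r ∷ p ∷ q ∷ a ∷ []))
      4G∤G : ¬ + 4 * G ∣ + 1 * G
      4G∤G h = let divides q q≡ = ∣-cancelʳ {+ 4} {+ 1} G≢0 h in 1≢2* (+ 2 * q) (trans q≡ (regroup q))
        where
        regroup : ∀ q → q * + 4 ≡ + 2 * (+ 2 * q)
        regroup = solve-∀
      half-odd : ∀ w z y y′ k j {N} → N ≡ + 8 * n → w + n * t ≡ + 4 * y → z + n * t ≡ + 4 * y′ → Odd z →
        k * (w + z) ≡ N * j → ∃ λ r → k ≡ + 4 * r
      half-odd w z y y′ k j refl y≡ y′≡ (q , z≡) s =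
        cancel-odd {z + + 2 * (y - y′)} {k} {n * j} (q + y - y′ , combination₁ (+ 1) z≡ (solve (z ∷ q ∷ y ∷ y′ ∷ [])))
          (cancelˡ {+ 2} (λ ()) (combination₃ (+ 1) (- k) k s y≡ y′≡ (solve (n ∷ t ∷ w ∷ z ∷ y ∷ y′ ∷ k ∷ j ∷ []))))
      scale : ∀ x k r → x ≡ k * G → k ≡ + 4 * r → + 1 * x ≡ r * (+ 4 * G)
      scale x k r k≡ r≡ = combination₂ (+ 1) G k≡ r≡ (solve (G ∷ k ∷ r ∷ x ∷ []))
      multiple : ∀ {u v} → u ∈ us → v ∈ us → + 4 * G ∣ + 1 * (u * u - v * v)
      multiple {u} {v} u∈ v∈ =
        let w , w∈ , w≡ = closedᵃ u∈
            z , z∈ , z≡ = closedᵃ v∈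
            divides k k≡ = G∣ u∈ v∈
            divides j j≡ = G∣ w∈ z∈
            y , y≡ = class-mod-4 w∈ (translate b≡ closedᵇ u∈ w≡)
            y′ , y′≡ = class-mod-4 z∈ (translate b≡ closedᵇ v∈ z≡)
            r , r≡ = half-odd w z y y′ k j N≡ y≡ y′≡ (us-odd z∈) (quotient-step u v w z k j w≡ z≡ k≡ j≡)
        in divides r (scale (u * u - v * v) k r k≡ r≡)

    -- With `4d = tN`, an even `t` can be halved. For odd `t` the factors 2 on the left pass to `N`
    -- one by one, and the evenness of `d` supplies the third: `N = 8n` and `d = 2nt`, which `8∤N`
    -- excludes.
    N∣2d : ∀ {u} → u ∈ us → N ∣ + 2 * d
    N∣2d {u} u∈ = let divides t t≡ = N∣4d in by-parity t≡ (parity t)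
      where
      by-parity : ∀ {t} → + 4 * d ≡ t * N → Even t ⊎ Odd t → N ∣ + 2 * d
      by-parity {t} t≡ (inj₁ (q , q≡)) =
        divides q (cancelˡ {+ 2} (λ ()) (combination₂ (+ 1) N t≡ q≡ (solve (d ∷ N ∷ t ∷ q ∷ []))))
      by-parity {t} t≡ (inj₂ t-odd) = step₁ (odd*even⇒even {t} {N} {+ 2 * d} t-odd (combination₁ (- + 1) t≡ (solve (d ∷ t ∷ N ∷ []))))
        where
        step₄ : ∀ {n₁ n₂ d′} → N ≡ + 2 * n₁ → d ≡ + 2 * d′ → n₁ ≡ + 2 * n₂ → Even n₂ → ⊥
        step₄ {n₁} {n₂} N≡ d≡ n₁≡ (n , n₂≡) = 8∤N {n} {t} N≡8n
          (cancelˡ {+ 4} (λ ()) (combination₂ (+ 1) t t≡ N≡8n (solve (t ∷ N ∷ n ∷ d ∷ [])))) t-odd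
          where
          N≡8n : N ≡ + 8 * n
          N≡8n = combination₃ (+ 1) (+ 2) (+ 4) N≡ n₁≡ n₂≡ (solve (N ∷ n₁ ∷ n₂ ∷ n ∷ []))
        step₃ : ∀ {n₁ d′} → N ≡ + 2 * n₁ → d ≡ + 2 * d′ → t * n₁ ≡ + 4 * d′ → Even n₁ → ⊥
        step₃ {n₁} {d′} N≡ d≡ tn₁≡ (n₂ , n₁≡) = step₄ {d′ = d′} N≡ d≡ n₁≡ (odd*even⇒even {t} {n₂} {d′} t-odd
          (cancelˡ {+ 2} (λ ()) (combination₂ (+ 1) (- t) tn₁≡ n₁≡ (solve (t ∷ n₁ ∷ n₂ ∷ d′ ∷ [])))))
        step₂ : ∀ {n₁} → N ≡ + 2 * n₁ → Even d → ⊥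
        step₂ {n₁} N≡ (d′ , d≡) = step₃ N≡ d≡ tn₁≡ (odd*even⇒even {t} {n₁} {+ 2 * d′} t-odd (trans tn₁≡ (regroup d′)))
          where
          tn₁≡ : t * n₁ ≡ + 4 * d′
          tn₁≡ = cancelˡ {+ 2} (λ ()) (combination₃ (- + 1) (- t) (+ 4) t≡ N≡ d≡ (solve (t ∷ N ∷ n₁ ∷ d ∷ d′ ∷ [])))
          regroup : ∀ z → + 4 * z ≡ + 2 * (+ 2 * z)
          regroup = solve-∀
        step₁ : Even N → N ∣ + 2 * d
        step₁ (n₁ , N≡) = ⊥-elim (step₂ {n₁} N≡ (gap-even (closedᵃ u∈)))
          where
          gap-even : (∃ λ w → w ∈ us × N * w ≡ u * u + a) → Even d
          -- For even `N` both `w` and `w + d` are odd.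
          gap-even (w , w∈ , w≡) = difference (odd-odd⇒even (even⇒odd {n₁} N≡ (translate b≡ closedᵇ u∈ w≡)) (even⇒odd {n₁} N≡ w∈))
            where
            difference : Even (w + d - w) → Even d
            difference (q , q≡) = q , combination₁ (+ 1) q≡ (solve (w ∷ d ∷ q ∷ []))

-- Integer inequalities and extreme absolute values.

-- Inequalities are kept in the form 0 ≤ e; a contradiction is a sum of products of such facts
-- that equals -1 modulo the hypotheses.
infixl 6 _⊕_
infixl 7 _⊗_

_⊕_ : ∀ {x y} → 0ℤ ≤ᶻ x → 0ℤ ≤ᶻ y → 0ℤ ≤ᶻ x + y
_⊕_ = +-mono-≤

_⊗_ : ∀ {x y} → 0ℤ ≤ᶻ x → 0ℤ ≤ᶻ y → 0ℤ ≤ᶻ x * y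
_⊗_ {x} {y} p q = subst (_≤ᶻ x * y) (*-zeroʳ x) (*-monoˡ-≤-nonNeg x {{nonNegative p}} q)

0≤+ : ∀ n → 0ℤ ≤ᶻ + n
0≤+ n = +≤+ ℕ.z≤n

by : ∀ {x y} → 0ℤ ≤ᶻ x → x ≡ y → 0ℤ ≤ᶻ y
by p refl = p

0≤⇒≢-1 : ∀ {x} → 0ℤ ≤ᶻ x → x ≢ - + 1
0≤⇒≢-1 () refl

positive⇒≢0 : ∀ {x} → 0ℤ ≤ᶻ x - + 1 → x ≢ 0ℤ
positive⇒≢0 p refl = 0≤⇒≢-1 p refl

dichotomy : ∀ x → 0ℤ ≤ᶻ x ⊎ 0ℤ ≤ᶻ - x - + 1
dichotomy (+ n) = inj₁ (0≤+ n)
dichotomy -[1+ n ] = inj₂ (0≤+ n)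

-- Integrality sharpens `x < 0` to `x ≤ -1`, so a refuted bound becomes again a fact of the form
-- `0 ≤ e`.
≱0 : ∀ x → ¬ 0ℤ ≤ᶻ x → 0ℤ ≤ᶻ - x - + 1
≱0 x ¬p = [ (λ p → ⊥-elim (¬p p)) , (λ p → p) ]′ (dichotomy x)

0≤square : ∀ x → 0ℤ ≤ᶻ x * x
0≤square (+ n) = 0≤+ n ⊗ 0≤+ n
0≤square -[1+ n ] = 0≤+ _

Between : ℤ → ℤ → ℤ → Set
Between m U x = (0ℤ ≤ᶻ x - m) × (0ℤ ≤ᶻ U - x)

Within : ℤ → ℤ → ℤ → Set
Within m U x = Between m U x ⊎ Between m U (- x)

-- The bounds `m` and `U` are attained only up to sign. The maps depend on the square alone, so the
-- equations `u₋²` and `u₊²` suffice to evaluate them at `m` and `U`.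
record Extremes (us : List ℤ) : Set where
  field
    m U : ℤ
    0≤m : 0ℤ ≤ᶻ m
    u₋ u₊ : ℤ
    u₋∈ : u₋ ∈ us
    u₊∈ : u₊ ∈ us
    u₋² : u₋ * u₋ ≡ m * m
    u₊² : u₊ * u₊ ≡ U * U
    within : ∀ {u} → u ∈ us → Within m U u

extremes : ∀ {us u₀} → u₀ ∈ us → Extremes us
extremes {us} {u₀} u₀∈ = record
  { m = + ∣ least ∣ ; U = + ∣ greatest ∣ ; 0≤m = 0≤+ _
  ; u₋ = least ; u₊ = greatest
  ; u₋∈ = [ (λ e → subst (_∈ us) (sym e) u₀∈) , (λ i → i) ]′ (argmin-sel ∣_∣ u₀ us)
  ; u₊∈ = [ (λ e → subst (_∈ us) (sym e) u₀∈) , (λ i → i) ]′ (argmax-sel ∣_∣ u₀ us)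
  ; u₋² = square least ; u₊² = square greatest
  ; within = λ {u} i → within-± {U = + ∣ greatest ∣} {+ ∣ u ∣} (+∣i∣≡i⊎+∣i∣≡-i u)
      ( i≤j⇒0≤j-i (+≤+ (All.lookup (f[argmin]≤f[xs] {f = ∣_∣} u₀ us) i))
      , i≤j⇒0≤j-i (+≤+ (All.lookup (f[xs]≤f[argmax] {f = ∣_∣} u₀ us) i)))
  }
  where
  least greatest : ℤ
  least = argmin ∣_∣ u₀ us
  greatest = argmax ∣_∣ u₀ us
  square-± : ∀ {u v} → v ≡ u ⊎ v ≡ - u → u * u ≡ v * v
  square-± (inj₁ refl) = refl
  square-± {u} (inj₂ refl) = solve (u ∷ [])
  square : ∀ u → u * u ≡ + ∣ u ∣ * + ∣ u ∣
  square u = square-± (+∣i∣≡i⊎+∣i∣≡-i u)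
  within-± : ∀ {m U v u} → v ≡ u ⊎ v ≡ - u → Between m U v → Within m U u
  within-± (inj₁ refl) b = inj₁ b
  within-± (inj₂ refl) b = inj₂ b

squeeze : ∀ {x y} → 0ℤ ≤ᶻ x - y → 0ℤ ≤ᶻ y - x → x ≡ y
squeeze p q = ≤-antisym (0≤i-j⇒j≤i q) (0≤i-j⇒j≤i p)

-- Equal gaps with `N = 2d` force `N = 4`.

module _ {N : ℤ} {us : List ℤ} (N>0 : 0ℤ ≤ᶻ N - + 1)
         (coprime : ∀ {u} → u ∈ us → ∀ {x} → N ∣ u * x → N ∣ x)
         {a d : ℤ} (N≡2d : N ≡ + 2 * d) (closed : (N , a) Closed us)
         (triple : ∀ {u w} → u ∈ us → N * w ≡ u * u + a → Triple us d d w)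
         where

  private
    N≢0 : N ≢ 0ℤ
    N≢0 = positive⇒≢0 N>0

  quarter : ∀ {u} → u ∈ us → ∃ λ A → d ≡ + 2 * A
  quarter u∈ =
    let w , _ , w≡ = closed u∈
        w∈ , w₁∈ , _ = triple u∈ w≡
        A , A≡ = odd-odd⇒even (even⇒odd N≢0 coprime {d} N≡2d w₁∈) (even⇒odd N≢0 coprime {d} N≡2d w∈)
    in A , difference w A A≡
    where
    difference : ∀ w A → w + d - w ≡ + 2 * A → d ≡ + 2 * A
    difference w A A≡ = combination₁ (+ 1) A≡ (solve (w ∷ d ∷ A ∷ []))

  module _ {A} (d≡2A : d ≡ + 2 * A) where

    private
      N≡4A : N ≡ + 4 * A
      N≡4A = combination₂ (+ 1) (+ 2) N≡2d d≡2A (solve (N ∷ d ∷ A ∷ []))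

    -- With N = 4A, the images of w, w + 2A and w + 4A are y, y + w + A and y + 2w + 4A; as all square
    -- differences are divisible by N, so are 8y + 4w and 4y + 4w, hence 4w and 4.
    shift₁ : ∀ w y z → N * y ≡ w * w + a → N * z ≡ (w + d) * (w + d) + a → z ≡ y + w + A
    shift₁ w y z y≡ z≡ = cancelˡ N≢0 (combination₂ (+ 1) (- + 1) z≡ y≡ (identity N≡4A d≡2A))
      where
      identity : ∀ {N d} → N ≡ + 4 * A → d ≡ + 2 * A →
        N * z - N * (y + w + A) ≡ + 1 * (N * z - ((w + d) * (w + d) + a)) + - + 1 * (N * y - (w * w + a))
      identity refl refl = solve (A ∷ a ∷ w ∷ y ∷ z ∷ [])

    shift₂ : ∀ w y z → N * y ≡ w * w + a → N * z ≡ (w + d + d) * (w + d + d) + a → z ≡ y + + 2 * w + N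
    shift₂ w y z y≡ z≡ = cancelˡ N≢0 (combination₃ (+ 1) (- + 1) (- (+ 2 * w + N + + 2 * d)) z≡ y≡ N≡2d
      (solve (N ∷ a ∷ d ∷ w ∷ y ∷ z ∷ [])))

    N∣4 : ∀ {u} → u ∈ us → N ∣ + 4
    N∣4 u∈ =
      let w , _ , w≡ = closed u∈
          w∈ , w₁∈ , w₂∈ = triple u∈ w≡
          y , y∈ , y≡ = closed w∈
          z₁ , z₁∈ , z₁≡ = closed w₁∈
          z₂ , z₂∈ , z₂≡ = closed w₂∈
          divides q q≡ = squareDifference-divisible {N} {a} {us} closed z₁∈ y∈
          divides r r≡ = squareDifference-divisible {N} {a} {us} closed z₂∈ y∈
          -- `z₁² - y² = (w + A)(2y + w + A)`; multiplied by 4 this is `w(8y + 4w)` plus multiples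
          -- of `N = 4A`.
          divides s s≡ = coprime w∈ {+ 8 * y + + 4 * w} (divides (+ 4 * q - + 2 * w - + 2 * y - A) (factor₁ w y z₁ q (shift₁ w y z₁ y≡ z₁≡) q≡))
          divides t t≡ = coprime w∈ {+ 4 * y + + 4 * w} (divides (r - + 4 * w - + 2 * y - N) (factor₂ w y z₂ r (shift₂ w y z₂ y≡ z₂≡) r≡))
      in coprime w∈ {+ 4} (divides (+ 2 * t - s) (combine w y s t s≡ t≡))
      where
      factor₁ : ∀ w y z q → z ≡ y + w + A → z * z - y * y ≡ q * N →
        w * (+ 8 * y + + 4 * w) ≡ (+ 4 * q - + 2 * w - + 2 * y - A) * N
      factor₁ w y z q refl q≡ = combination₂ (+ 4) (+ 2 * w + + 2 * y + A) q≡ N≡4A (solve (N ∷ A ∷ w ∷ y ∷ q ∷ []))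
      factor₂ : ∀ w y z r → z ≡ y + + 2 * w + N → z * z - y * y ≡ r * N →
        w * (+ 4 * y + + 4 * w) ≡ (r - + 4 * w - + 2 * y - N) * N
      factor₂ w y z r refl r≡ = combination₁ (+ 1) r≡ (solve (N ∷ w ∷ y ∷ r ∷ []))
      combine : ∀ w y s t → + 8 * y + + 4 * w ≡ s * N → + 4 * y + + 4 * w ≡ t * N → w * + 4 ≡ (+ 2 * t - s) * N
      combine w y s t s≡ t≡ = combination₂ (- + 1) (+ 2) s≡ t≡ (solve (N ∷ w ∷ y ∷ s ∷ t ∷ []))

    N∣4⇒N≡4 : ∀ s → + 4 ≡ s * N → N ≡ + 4
    N∣4⇒N≡4 s s≡ = combination₂ (+ 1) (+ 4) N≡4A (squeeze {A} {+ 1} 0≤A-1 0≤1-A) (solve (N ∷ A ∷ []))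
      where
      0≰-A : ¬ 0ℤ ≤ᶻ - A
      0≰-A p = 0≤⇒≢-1 (N>0 ⊕ 0≤+ 4 ⊗ p) (combination₁ (+ 1) N≡4A (solve (N ∷ A ∷ [])))
      0≤A-1 : 0ℤ ≤ᶻ A - + 1
      0≤A-1 = by (≱0 (- A) 0≰-A) (solve (A ∷ []))
      0≤A : 0ℤ ≤ᶻ A
      0≤A = by (0≤A-1 ⊕ 0≤+ 1) (solve (A ∷ []))
      sA≡1 : s * A ≡ + 1
      sA≡1 = cancelˡ {+ 4} (λ ()) (combination₂ (- + 1) (- s) s≡ N≡4A (solve (s ∷ N ∷ A ∷ [])))
      0≰-s : ¬ 0ℤ ≤ᶻ - s
      0≰-s p = 0≤⇒≢-1 (p ⊗ 0≤A) (combination₁ (- + 1) sA≡1 (solve (s ∷ A ∷ [])))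
      0≤s-1 : 0ℤ ≤ᶻ s - + 1
      0≤s-1 = by (≱0 (- s) 0≰-s) (solve (s ∷ []))
      0≤1-A : 0ℤ ≤ᶻ + 1 - A
      0≤1-A = by (0≤s-1 ⊗ 0≤A) (combination₁ (+ 1) sA≡1 (solve (s ∷ A ∷ [])))

    N≡4 : ∀ {u} → u ∈ us → N ≡ + 4
    N≡4 u∈ = let divides s s≡ = N∣4 u∈ in N∣4⇒N≡4 s s≡

-- Classification for `N = 4` and gaps 2.

odd-root : ∀ {x y} → Odd x → x * x ≡ y * y → Odd y
odd-root {x} {y} (r , x≡) e = from-parity (parity y)
  where
  not-even : ¬ Even y
  not-even (q , y≡) = 1≢2* (+ 2 * q * q - + 2 * r * r - + 2 * r) (expand x≡ y≡ e)
    where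
    expand : ∀ {x y} → x ≡ + 2 * r + + 1 → y ≡ + 2 * q → x * x ≡ y * y →
      + 1 ≡ + 2 * (+ 2 * q * q - + 2 * r * r - + 2 * r)
    expand refl refl e = combination₁ (+ 1) e (solve (q ∷ r ∷ []))
  from-parity : Even y ⊎ Odd y → Odd y
  from-parity (inj₁ p) = ⊥-elim (not-even p)
  from-parity (inj₂ p) = p

lower-bound : ∀ {m U} u → 0ℤ ≤ᶻ m → Within m U u → 0ℤ ≤ᶻ u + U
lower-bound {m} {U} u 0≤m (inj₁ (p , q)) = by (p ⊕ (p ⊕ q) ⊕ 0≤+ 2 ⊗ 0≤m) (solve (u ∷ m ∷ U ∷ []))
lower-bound {m} {U} u 0≤m (inj₂ (p , q)) = by q (solve (u ∷ U ∷ []))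

upper-bound : ∀ {m U} u → 0ℤ ≤ᶻ m → Within m U u → 0ℤ ≤ᶻ U - u
upper-bound {m} {U} u 0≤m (inj₁ (p , q)) = q
upper-bound {m} {U} u 0≤m (inj₂ (p , q)) = by (p ⊕ (p ⊕ q) ⊕ 0≤+ 2 ⊗ 0≤m) (solve (u ∷ m ∷ U ∷ []))

odd-up-to-3 odd-up-to-5 : List ℤ
odd-up-to-3 = + 1 ∷ - + 1 ∷ + 3 ∷ - + 3 ∷ []
odd-up-to-5 = + 1 ∷ - + 1 ∷ + 3 ∷ - + 3 ∷ + 5 ∷ - + 5 ∷ []

small-odd : ∀ u → 0ℤ ≤ᶻ u + + 5 → 0ℤ ≤ᶻ + 5 - u → Odd u → u ∈ odd-up-to-5
small-odd (+ 0) _ _ o = ⊥-elim (even∧odd⇒⊥ (+ 0 , refl) o)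
small-odd (+ 1) _ _ o = here refl
small-odd (+ 2) _ _ o = ⊥-elim (even∧odd⇒⊥ (+ 1 , refl) o)
small-odd (+ 3) _ _ o = there (there (here refl))
small-odd (+ 4) _ _ o = ⊥-elim (even∧odd⇒⊥ (+ 2 , refl) o)
small-odd (+ 5) _ _ o = there (there (there (there (here refl))))
small-odd (+ suc (suc (suc (suc (suc (suc n)))))) _ () o
small-odd -[1+ 0 ] _ _ o = there (here refl)
small-odd -[1+ 1 ] _ _ o = ⊥-elim (even∧odd⇒⊥ (- + 1 , refl) o)
small-odd -[1+ 2 ] _ _ o = there (there (there (here refl)))
small-odd -[1+ 3 ] _ _ o = ⊥-elim (even∧odd⇒⊥ (- + 2 , refl) o)
small-odd -[1+ 4 ] _ _ o = there (there (there (there (there (here refl)))))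
small-odd -[1+ suc (suc (suc (suc (suc n)))) ] () _ o

-- For `N = 4` the offset `a` is 16 times the smallest constant of the three, so -21 and -13 stand
-- for -21/16 and -13/16.
Classified : List ℤ → ℤ → Set
Classified us a = (a ≡ - + 21 × (∀ {u} → u ∈ us → u ∈ odd-up-to-5)) ⊎ (a ≡ - + 13 × (∀ {u} → u ∈ us → u ∈ odd-up-to-3))

module _ {us : List ℤ} {a : ℤ}
         (closed : (+ 4 , a) Closed us)
         (triple : ∀ {u w} → u ∈ us → + 4 * w ≡ u * u + a → Triple us (+ 2) (+ 2) w)
         (us-odd : ∀ {u} → u ∈ us → Odd u)
         {m U : ℤ} (0≤m : 0ℤ ≤ᶻ m) (within : ∀ {u} → u ∈ us → Within m U u)
         where

  module _ {w W} (w≡ : + 4 * w ≡ m * m + a) (W≡ : + 4 * W ≡ U * U + a)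
           (0≤w+U : 0ℤ ≤ᶻ w + U) (W₂≤U : 0ℤ ≤ᶻ U - (W + + 2 + + 2)) where

    -- From `4(W - w) = U² - m²` and `W - w ≤ 2U - 4` follows `(U - 4)² ≤ m²`.
    U≤m+4 : 0ℤ ≤ᶻ m + + 4 - U
    U≤m+4 = by (≱0 (U - m - + 5) absurd) (solve (m ∷ U ∷ []))
      where
      absurd : ¬ 0ℤ ≤ᶻ U - m - + 5
      absurd p = 0≤⇒≢-1 (0≤+ 4 ⊗ (0≤w+U ⊕ W₂≤U) ⊕ p ⊗ (p ⊕ 0≤+ 1 ⊕ 0≤+ 2 ⊗ 0≤m) ⊕ p ⊕ 0≤+ 2 ⊗ 0≤m)
        (combination₂ (+ 1) (- + 1) w≡ W≡ (solve (m ∷ U ∷ a ∷ w ∷ W ∷ [])))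

    module _ (m≥2 : 0ℤ ≤ᶻ m - + 2) where

      no-crossing : ∀ w → Between m U w → ¬ Between m U (- (w + + 2))
      no-crossing w (p , _) (q , _) = 0≤⇒≢-1 (p ⊕ q ⊕ 0≤+ 2 ⊗ m≥2 ⊕ 0≤+ 5) (solve (w ∷ m ∷ []))

      -- The hole between `-m` and `m` has width at least 4, too wide for a step of 2.
      no-crossing′ : ∀ w → Between m U (- w) → ¬ Between m U (w + + 2)
      no-crossing′ w (p , _) (q , _) = 0≤⇒≢-1 (p ⊕ q ⊕ 0≤+ 2 ⊗ m≥2 ⊕ 0≤+ 1) (solve (w ∷ m ∷ []))

      -- The triple stays on one side of 0 and spans 4. Since `U ≤ m + 4`, it must reach from one
      -- end of `[m , U]` or its negative to the other.
      extremal : ∀ w → Triple us (+ 2) (+ 2) w → w ≡ m ⊎ w ≡ - m - + 4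
      extremal w (w∈ , w₁∈ , w₂∈) = same-side (within w∈) (within w₁∈) (within w₂∈)
        where
        same-side : Within m U w → Within m U (w + + 2) → Within m U (w + + 2 + + 2) → w ≡ m ⊎ w ≡ - m - + 4
        same-side (inj₁ p) (inj₂ q) _ = ⊥-elim (no-crossing w p q)
        same-side _ (inj₁ p) (inj₂ q) = ⊥-elim (no-crossing (w + + 2) p q)
        same-side (inj₂ p) (inj₁ q) _ = ⊥-elim (no-crossing′ w p q)
        same-side _ (inj₂ p) (inj₁ q) = ⊥-elim (no-crossing′ (w + + 2) p q)
        same-side (inj₁ (p , _)) (inj₁ _) (inj₁ (_ , q)) = inj₁ (squeeze p (by (q ⊕ U≤m+4) (solve (w ∷ m ∷ U ∷ []))))
        same-side (inj₂ (_ , p)) (inj₂ _) (inj₂ (q , _)) = inj₂ (squeeze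
          (by (p ⊕ U≤m+4) (solve (w ∷ m ∷ U ∷ [])))
          (by q (solve (w ∷ m ∷ []))))

      -- The value w + 2 = ±(m + 2) is mapped to w + m + 1, which is not extremal.
      not-both-extremal : ∀ y → + 4 * y ≡ (w + + 2) * (w + + 2) + a → w ≡ m ⊎ w ≡ - m - + 4 → ¬ (y ≡ m ⊎ y ≡ - m - + 4)
      not-both-extremal y y≡ = λ p q → contradictory p q w≡ y≡
        where
        contradictory : ∀ {w y} → w ≡ m ⊎ w ≡ - m - + 4 → y ≡ m ⊎ y ≡ - m - + 4 →
          + 4 * w ≡ m * m + a → ¬ (+ 4 * y ≡ (w + + 2) * (w + + 2) + a)
        contradictory (inj₁ refl) (inj₁ refl) w≡ y≡ = 0≤⇒≢-1 (0≤+ 4 ⊗ 0≤m ⊕ 0≤+ 3)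
          (combination₂ (+ 1) (- + 1) w≡ y≡ (solve (m ∷ a ∷ [])))
        contradictory (inj₁ refl) (inj₂ refl) w≡ y≡ = 0≤⇒≢-1 (0≤+ 12 ⊗ 0≤m ⊕ 0≤+ 19)
          (combination₂ (+ 1) (- + 1) w≡ y≡ (solve (m ∷ a ∷ [])))
        contradictory (inj₂ refl) (inj₁ refl) w≡ y≡ = 0≤⇒≢-1 (0≤+ 4 ⊗ 0≤m ⊕ 0≤+ 11)
          (combination₂ (- + 1) (+ 1) w≡ y≡ (solve (m ∷ a ∷ [])))
        contradictory (inj₂ refl) (inj₂ refl) w≡ y≡ = 0≤⇒≢-1 (0≤+ 4 ⊗ 0≤m ⊕ 0≤+ 3)
          (combination₂ (+ 1) (- + 1) w≡ y≡ (solve (m ∷ a ∷ [])))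

    m≱2 : Triple us (+ 2) (+ 2) w → ¬ 0ℤ ≤ᶻ m - + 2
    m≱2 t@(_ , w₁∈ , _) m≥2 = let y , _ , y≡ = closed w₁∈ in
      not-both-extremal m≥2 y y≡ (extremal m≥2 w t) (extremal m≥2 y (triple w₁∈ y≡))

    m≡1 : Triple us (+ 2) (+ 2) w → Odd m → m ≡ + 1
    m≡1 t (q , m≡) = combination₂ (+ 1) (+ 2) m≡ (squeeze {q} {0ℤ} 0≤q q≤0) (solve (m ∷ q ∷ []))
      where
      0≤1-m : 0ℤ ≤ᶻ + 1 - m
      0≤1-m = by (≱0 (m - + 2) (m≱2 t)) (solve (m ∷ []))
      0≰-q-1 : ¬ 0ℤ ≤ᶻ - q - + 1
      0≰-q-1 p = 0≤⇒≢-1 (0≤m ⊕ 0≤+ 2 ⊗ p) (combination₁ (+ 1) m≡ (solve (m ∷ q ∷ [])))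
      0≤q : 0ℤ ≤ᶻ q - 0ℤ
      0≤q = by (≱0 (- q - + 1) 0≰-q-1) (solve (q ∷ []))
      0≰q-1 : ¬ 0ℤ ≤ᶻ q - + 1
      0≰q-1 p = 0≤⇒≢-1 (0≤1-m ⊕ 0≤+ 2 ⊗ p ⊕ 0≤+ 1) (combination₁ (- + 1) m≡ (solve (m ∷ q ∷ [])))
      q≤0 : 0ℤ ≤ᶻ 0ℤ - q
      q≤0 = by (≱0 (q - + 1) 0≰q-1) (solve (q ∷ []))

  module _ (m≡1 : m ≡ + 1) (U≤5 : 0ℤ ≤ᶻ + 5 - U) where

    small : ∀ {u} → u ∈ us → u ∈ odd-up-to-5
    small {u} u∈ = small-odd u
      (by (lower-bound {m} {U} u 0≤m (within u∈) ⊕ U≤5) (solve (u ∷ U ∷ [])))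
      (by (upper-bound {m} {U} u 0≤m (within u∈) ⊕ U≤5) (solve (u ∷ U ∷ []))) (us-odd u∈)

    too-big : ∀ n → + 6 + + n ∈ us → ⊥
    too-big n z∈ = beyond (+ n) (0≤+ n) (upper-bound {m} {U} (+ 6 + + n) 0≤m (within z∈) ⊕ U≤5)
      where
      beyond : ∀ x → 0ℤ ≤ᶻ x → 0ℤ ≤ᶻ U - (+ 6 + x) + (+ 5 - U) → ⊥
      beyond x 0≤x p = 0≤⇒≢-1 (p ⊕ 0≤x) (solve (U ∷ x ∷ []))

    -- A value of at least 2 under the lowest map means a value of at least 6 under the highest,
    -- beyond `U ≤ 5`.
    escape : ∀ {u} n → u ∈ us → + 4 * (+ 2 + + n) ≡ u * u + a → ⊥
    escape {u} n u∈ e = let _ , _ , z∈ = triple {u} {+ 2 + + n} u∈ e in too-big n (subst (_∈ us) (regroup (+ n)) z∈)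
      where
      regroup : ∀ x → + 2 + x + + 2 + + 2 ≡ + 6 + x
      regroup = solve-∀

    small-13 : ∀ {u} → a ≡ - + 13 → u ∈ us → u ∈ odd-up-to-5 → u ∈ odd-up-to-3
    small-13 refl u∈ (here refl) = here refl
    small-13 refl u∈ (there (here refl)) = there (here refl)
    small-13 refl u∈ (there (there (here refl))) = there (there (here refl))
    small-13 refl u∈ (there (there (there (here refl)))) = there (there (there (here refl)))
    -- At 5 and -5 the lowest map has the value `(25 - 13)/4 = 3`, which is `2 + 1`.
    small-13 refl u∈ (there (there (there (there (here refl))))) = ⊥-elim (escape 1 u∈ refl)
    small-13 refl u∈ (there (there (there (there (there (here refl)))))) = ⊥-elim (escape 1 u∈ refl)

    -- The value `w` of the lowest map at `m = 1` determines `a`. Of the six candidates only -3 and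
    -- -5 keep all images within 5.
    classify-by-value : ∀ {w} → w ∈ odd-up-to-5 → a ≡ + 4 * w - + 1 →
      Triple us (+ 2) (+ 2) w → Classified us a
    -- Here `a = 3`, and the point 5 goes to 7.
    classify-by-value (here refl) refl (_ , _ , w₂∈) = ⊥-elim (escape 5 w₂∈ refl)
    classify-by-value (there (here refl)) refl (_ , _ , w₂∈) =
      -- Here `a = -5`: the point 3 goes to 1, so 5 is a point too; it is fixed by the lowest map
      -- and sent to 9 by the highest.
      let _ , _ , z₂∈ = triple {w = + 1} w₂∈ refl in ⊥-elim (escape 3 z₂∈ refl)
    classify-by-value (there (there (here refl))) refl (_ , _ , w₂∈) = ⊥-elim (too-big 1 w₂∈)
    classify-by-value (there (there (there (here refl)))) refl _ = inj₂ (refl , λ u∈ → small-13 refl u∈ (small u∈))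
    classify-by-value (there (there (there (there (here refl))))) refl (_ , _ , w₂∈) = ⊥-elim (too-big 3 w₂∈)
    classify-by-value (there (there (there (there (there (here refl)))))) refl _ = inj₁ (refl , small)

    classify : ∀ {w} → + 4 * w ≡ m * m + a → Triple us (+ 2) (+ 2) w → Classified us a
    classify {w} w≡ t = classify-by-value (small (proj₁ t)) (intercept m≡1 w≡) t
      where
      intercept : ∀ {m} → m ≡ + 1 → + 4 * w ≡ m * m + a → a ≡ + 4 * w - + 1
      intercept refl w≡ = combination₁ (- + 1) w≡ (solve (a ∷ w ∷ []))

-- Three maps with positive gaps `d₁` and `d₂`.

module _ {N : ℤ} {us : List ℤ} (N>0 : 0ℤ ≤ᶻ N - + 1)
         (coprime : ∀ {u} → u ∈ us → ∀ {x} → N ∣ u * x → N ∣ x)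
         {a d₁ d₂ : ℤ} (d₁>0 : 0ℤ ≤ᶻ d₁ - + 1) (d₂>0 : 0ℤ ≤ᶻ d₂ - + 1)
         (closed₁ : (N , a) Closed us)
         (closed₂ : (N , a + N * d₁) Closed us)
         (closed₃ : (N , a + N * d₁ + N * d₂) Closed us)
         where

  private
    N≢0 : N ≢ 0ℤ
    N≢0 = positive⇒≢0 N>0

  triple : ∀ {u w} → u ∈ us → N * w ≡ u * u + a → Triple us d₁ d₂ w
  triple {u} {w} u∈ w≡ =
      (let z , z∈ , z≡ = closed₁ u∈ in subst (_∈ us) (cancelˡ N≢0 (trans z≡ (sym w≡))) z∈)
    , translate N≢0 coprime refl closed₂ u∈ w≡
    , translate N≢0 coprime refl closed₃ u∈ shifted
    where
    shifted : N * (w + d₁) ≡ u * u + (a + N * d₁)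
    shifted = combination₁ (+ 1) w≡ (solve (N ∷ w ∷ u ∷ d₁ ∷ a ∷ []))

  -- If `G` were 0, the three distinct numbers `w`, `w + d₁` and `w + d₁ + d₂` would have the same
  -- square.
  squareDifferences-nonzero : ∀ {G u} → u ∈ us → IsGCD (SquareDifference us) G → G ≢ 0ℤ
  squareDifferences-nonzero {u = u} u∈ (G∣ , _) refl =
    let w , _ , w≡ = closed₁ u∈
        w∈ , w₁∈ , w₂∈ = triple u∈ w≡
        divides q q≡ = G∣ (w + d₁ , w , w₁∈ , w∈ , refl)
        divides r r≡ = G∣ (w + d₁ + d₂ , w + d₁ , w₂∈ , w₁∈ , refl)
    in clash w (trans q≡ (*-zeroʳ q)) (trans r≡ (*-zeroʳ r))
    where
    clash : ∀ w → (w + d₁) * (w + d₁) - w * w ≡ 0ℤ →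
      (w + d₁ + d₂) * (w + d₁ + d₂) - (w + d₁) * (w + d₁) ≡ 0ℤ → ⊥
    clash w p q = 0≤⇒≢-1 (d₁>0 ⊕ d₂>0 ⊕ 0≤+ 1) (combination₂ (- + 1) (+ 1) p′ q′ (solve (w ∷ d₁ ∷ d₂ ∷ [])))
      where
      p′ : + 2 * w + d₁ ≡ 0ℤ
      p′ = cancelˡ {d₁} (positive⇒≢0 d₁>0) (combination₁ (+ 1) p (solve (w ∷ d₁ ∷ [])))
      q′ : + 2 * w + + 2 * d₁ + d₂ ≡ 0ℤ
      q′ = cancelˡ {d₂} (positive⇒≢0 d₂>0) (combination₁ (+ 1) q (solve (w ∷ d₁ ∷ d₂ ∷ [])))

  half-integral : ∀ {u} → u ∈ us → (N ∣ + 2 * d₁) × (N ∣ + 2 * d₂)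
  half-integral u∈ =
    let G , isGCD = gcd-squareDifferences u∈
        G≢0 = squareDifferences-nonzero u∈ isGCD
    in N∣2d N≢0 coprime refl closed₁ closed₂ isGCD G≢0 u∈ , N∣2d N≢0 coprime refl closed₂ closed₃ isGCD G≢0 u∈

  multiplier-positive : ∀ {k d} → + 2 * d ≡ k * N → 0ℤ ≤ᶻ d - + 1 → 0ℤ ≤ᶻ k - + 1
  multiplier-positive {k} {d} k≡ d>0 = by (≱0 (- k) absurd) (solve (k ∷ []))
    where
    absurd : ¬ 0ℤ ≤ᶻ - k
    absurd p = 0≤⇒≢-1 (p ⊗ N>0 ⊕ p ⊕ d>0 ⊕ d>0 ⊕ 0≤+ 1) (combination₁ (+ 1) k≡ (solve (k ∷ d ∷ N ∷ [])))

  module _ {m U : ℤ} (0≤m : 0ℤ ≤ᶻ m) where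

    private
      0≤N : 0ℤ ≤ᶻ N
      0≤N = by (N>0 ⊕ 0≤+ 1) (solve (N ∷ []))

    -- For k₁ + k₂ ≥ 3 the bound 2(U - N)² + N² ≤ 2m² gives U - m < N < 2m.  So the values of the
    -- middle map all lie on one side of 0, and this makes U² - m² too small.
    module _ {k₁ k₂} (k₁≡ : + 2 * d₁ ≡ k₁ * N) (k₂≡ : + 2 * d₂ ≡ k₂ * N) (k≥3 : 0ℤ ≤ᶻ k₁ + k₂ - + 3)
             {w W} (w≡ : N * w ≡ m * m + a) (W≡ : N * W ≡ U * U + a) (0≤w+U : 0ℤ ≤ᶻ w + U) (W₂≤U : 0ℤ ≤ᶻ U - (W + d₁ + d₂)) where

      -- This is `2(U - N)² + N² ≤ 2m²`. It combines `N(W - w) = U² - m²` with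
      -- `W - w ≤ 2U - d₁ - d₂` and `2(d₁ + d₂) = (k₁ + k₂)N ≥ 3N`.
      spread : 0ℤ ≤ᶻ + 4 * (N * U) - + 3 * (N * N) - + 2 * (U * U) + + 2 * (m * m)
      spread = by
        (0≤+ 2 ⊗ 0≤N ⊗ (0≤w+U ⊕ W₂≤U) ⊕ 0≤N ⊗ 0≤N ⊗ k≥3)
        (step (combination₂ {+ 2 * N * (d₁ + d₂)} {(k₁ + k₂) * (N * N)} N N k₁≡ k₂≡ (solve (N ∷ d₁ ∷ d₂ ∷ k₁ ∷ k₂ ∷ []))))
        where
        step : + 2 * N * (d₁ + d₂) ≡ (k₁ + k₂) * (N * N) →
          + 2 * N * (w + U + (U - (W + d₁ + d₂))) + N * N * (k₁ + k₂ - + 3)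
          ≡ + 4 * (N * U) - + 3 * (N * N) - + 2 * (U * U) + + 2 * (m * m)
        step s = combination₃ (- + 1) (+ 2) (- + 2) s w≡ W≡
          (solve (N ∷ U ∷ m ∷ w ∷ W ∷ a ∷ d₁ ∷ d₂ ∷ k₁ ∷ k₂ ∷ []))

      U-m<N : 0ℤ ≤ᶻ N + m - U - + 1
      U-m<N = by (≱0 (U - N - m) absurd) (solve (N ∷ m ∷ U ∷ []))
        where
        absurd : ¬ 0ℤ ≤ᶻ U - N - m
        -- `U - N ≥ m` would give `2(U - N)² ≥ 2m²`, leaving no room for `N²` in `spread`.
        absurd p = 0≤⇒≢-1
          (spread ⊕ 0≤+ 2 ⊗ p ⊗ (p ⊕ 0≤+ 2 ⊗ 0≤m) ⊕ N>0 ⊗ N>0 ⊕ 0≤+ 2 ⊗ N>0)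
          (solve (N ∷ U ∷ m ∷ []))

      N<2m : 0ℤ ≤ᶻ + 2 * m - N - + 1
      N<2m = by (≱0 (N - + 2 * m) absurd) (solve (N ∷ m ∷ []))
        where
        absurd : ¬ 0ℤ ≤ᶻ N - + 2 * m
        -- Twice `spread` gives `2N² ≤ 4m²`, while `N ≥ 2m` gives `4m² ≤ N²`.
        absurd p = 0≤⇒≢-1
          (0≤+ 2 ⊗ spread ⊕ p ⊗ (0≤N ⊕ 0≤+ 2 ⊗ 0≤m) ⊕ 0≤+ 4 ⊗ 0≤square (U - N) ⊕ N>0 ⊗ N>0 ⊕ 0≤+ 2 ⊗ N>0)
          (solve (N ∷ U ∷ m ∷ []))

      k≤1 : ∀ {k d} → + 2 * d ≡ k * N → 0ℤ ≤ᶻ U - m - d → 0ℤ ≤ᶻ + 1 - k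
      k≤1 {k} {d} k≡ d≤ = by (≱0 (k - + 2) absurd) (solve (k ∷ []))
        where
        absurd : ¬ 0ℤ ≤ᶻ k - + 2
        absurd p = 0≤⇒≢-1 (p ⊗ 0≤N ⊕ 0≤+ 2 ⊗ d≤ ⊕ 0≤+ 2 ⊗ U-m<N ⊕ 0≤+ 1)
          (combination₁ (- + 1) k≡ (solve (N ∷ U ∷ m ∷ d ∷ k ∷ [])))

      not-both-small : 0ℤ ≤ᶻ U - m - d₁ → ¬ 0ℤ ≤ᶻ U - m - d₂
      not-both-small p q = 0≤⇒≢-1 (k≥3 ⊕ k≤1 {k₁} k₁≡ p ⊕ k≤1 {k₂} k₂≡ q) (solve (k₁ ∷ k₂ ∷ []))

      -- `(U - m)(U + m) = N(W - w) ≤ N(U - m - d)` is impossible because `U + m ≥ 2m > N`.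
      one-sided : ∀ {d} → 0ℤ ≤ᶻ d - + 1 → 0ℤ ≤ᶻ U - m - d → ¬ 0ℤ ≤ᶻ U - m - d - (W - w)
      one-sided {d} d>0 p q = 0≤⇒≢-1
        (0≤N ⊗ q ⊕ (p ⊕ d>0 ⊕ 0≤+ 1) ⊗ (p ⊕ d>0 ⊕ N<2m ⊕ 0≤+ 2) ⊕ N>0 ⊗ d>0 ⊕ N>0 ⊕ d>0)
        (combination₂ (+ 1) (- + 1) w≡ W≡ (solve (N ∷ U ∷ m ∷ d ∷ w ∷ W ∷ a ∷ [])))

      gap-below : ∀ w → 0ℤ ≤ᶻ w + U → Between m U (- (w + d₁)) → 0ℤ ≤ᶻ U - m - d₁
      gap-below w p (q , _) = by (p ⊕ q) (solve (U ∷ m ∷ w ∷ d₁ ∷ []))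

      gap-above : ∀ w → 0ℤ ≤ᶻ U - (w + d₁ + d₂) → Between m U (w + d₁) → 0ℤ ≤ᶻ U - m - d₂
      gap-above w p (q , _) = by (p ⊕ q) (solve (U ∷ m ∷ w ∷ d₁ ∷ d₂ ∷ []))

      -- The cases are the signs of the middle values at `m` and at `U`. Equal signs confine `W - w`
      -- as `one-sided` requires; opposite signs make both gaps at most `U - m`.
      wide-gaps-impossible : 0ℤ ≤ᶻ W + U → 0ℤ ≤ᶻ U - (w + d₁ + d₂) → Within m U (w + d₁) → Within m U (W + d₁) → ⊥
      wide-gaps-impossible 0≤W+U w₂≤U (inj₁ p) (inj₁ q) = one-sided {d₂} d₂>0 (gap-above w w₂≤U p)
        (by (W₂≤U ⊕ proj₁ p) (solve (U ∷ m ∷ w ∷ W ∷ d₁ ∷ d₂ ∷ [])))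
      wide-gaps-impossible 0≤W+U w₂≤U (inj₂ p) (inj₂ q) = one-sided {d₁} d₁>0 (gap-below w 0≤w+U p)
        (by (0≤w+U ⊕ proj₁ q) (solve (U ∷ m ∷ w ∷ W ∷ d₁ ∷ [])))
      wide-gaps-impossible 0≤W+U w₂≤U (inj₁ p) (inj₂ q) = not-both-small (gap-below W 0≤W+U q) (gap-above w w₂≤U p)
      wide-gaps-impossible 0≤W+U w₂≤U (inj₂ p) (inj₁ q) = not-both-small (gap-below w 0≤w+U p) (gap-above W W₂≤U q)

  module _ {u₀} (u₀∈ : u₀ ∈ us) where

    private
      open Extremes (extremes u₀∈)

      at-u₋ : ∀ {w} → N * w ≡ u₋ * u₋ + a → N * w ≡ m * m + a
      at-u₋ w≡ = trans w≡ (cong (λ x → x + a) u₋²)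

      at-u₊ : ∀ {w} → N * w ≡ u₊ * u₊ + a → N * w ≡ U * U + a
      at-u₊ w≡ = trans w≡ (cong (λ x → x + a) u₊²)

    narrow-gaps : ∀ {k₁ k₂} → + 2 * d₁ ≡ k₁ * N → + 2 * d₂ ≡ k₂ * N → 0ℤ ≤ᶻ - (k₁ + k₂ - + 3) - + 1
    narrow-gaps {k₁} {k₂} k₁≡ k₂≡ = ≱0 (k₁ + k₂ - + 3) λ k≥3 →
      let w , _ , w≡ = closed₁ u₋∈
          W , _ , W≡ = closed₁ u₊∈
          w∈ , w₁∈ , w₂∈ = triple u₋∈ w≡
          W∈ , W₁∈ , W₂∈ = triple u₊∈ W≡
      in wide-gaps-impossible 0≤m {k₁} {k₂} k₁≡ k₂≡ k≥3 {w} {W}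
           (at-u₋ w≡) (at-u₊ W≡)
           (lower-bound {m} {U} w 0≤m (within w∈)) (upper-bound {m} {U} (W + d₁ + d₂) 0≤m (within W₂∈))
           (lower-bound {m} {U} W 0≤m (within W∈)) (upper-bound {m} {U} (w + d₁ + d₂) 0≤m (within w₂∈))
           (within w₁∈) (within W₁∈)

    -- The multipliers are positive and by `narrow-gaps` their sum is at most 2, so both are 1.
    half-gaps : ∀ k₁ k₂ → + 2 * d₁ ≡ k₁ * N → + 2 * d₂ ≡ k₂ * N → N ≡ + 2 * d₁ × d₂ ≡ d₁
    half-gaps k₁ k₂ k₁≡ k₂≡ =
        combination₂ (- + 1) (- N) k₁≡ k₁≡1 (solve (N ∷ d₁ ∷ k₁ ∷ []))
      , cancelˡ {+ 2} (λ ()) (combination₂ (+ 1) (- + 1) (trans k₂≡ (cong (λ x → x * N) k₂≡1)) (trans k₁≡ (cong (λ x → x * N) k₁≡1))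
          (solve (N ∷ d₁ ∷ d₂ ∷ [])))
      where
      k₁>0 : 0ℤ ≤ᶻ k₁ - + 1
      k₁>0 = multiplier-positive {k₁} {d₁} k₁≡ d₁>0
      k₂>0 : 0ℤ ≤ᶻ k₂ - + 1
      k₂>0 = multiplier-positive {k₂} {d₂} k₂≡ d₂>0
      k₁≡1 : k₁ ≡ + 1
      k₁≡1 = squeeze k₁>0 (by (narrow-gaps {k₁} {k₂} k₁≡ k₂≡ ⊕ k₂>0) (solve (k₁ ∷ k₂ ∷ [])))
      k₂≡1 : k₂ ≡ + 1
      k₂≡1 = squeeze k₂>0 (by (narrow-gaps {k₁} {k₂} k₁≡ k₂≡ ⊕ k₁>0) (solve (k₁ ∷ k₂ ∷ [])))

    integer-classification : N ≡ + 4 × d₁ ≡ + 2 × d₂ ≡ + 2 × Classified us a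
    integer-classification =
      let divides k₁ k₁≡ , divides k₂ k₂≡ = half-integral u₀∈
          N≡2d , d₂≡d₁ = half-gaps k₁ k₂ k₁≡ k₂≡
      in equal-gaps N≡2d d₂≡d₁
      where
      four : ∀ {N} → N ≡ + 4 → N ≡ + 2 * d₁ → d₁ ≡ + 2
      four refl N≡2d = cancelˡ {+ 2} (λ ()) (sym N≡2d)
      final : N ≡ + 4 → d₁ ≡ + 2 → d₂ ≡ + 2 → Classified us a
      final refl refl refl =
        let w , _ , w≡ = closed₁ u₋∈
            W , _ , W≡ = closed₁ u₊∈
            t@(w∈ , _) = triple u₋∈ w≡
            _ , _ , W₂∈ = triple u₊∈ W≡
            us-odd = λ {u} → even⇒odd N≢0 coprime {+ 2} {u} refl
            0≤w+U = lower-bound {m} {U} w 0≤m (within w∈)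
            W₂≤U = upper-bound {m} {U} (W + + 2 + + 2) 0≤m (within W₂∈)
            m≡ = m≡1 closed₁ triple us-odd {m} {U} 0≤m within {w} {W} (at-u₋ w≡) (at-u₊ W≡) 0≤w+U W₂≤U t
                   (odd-root (us-odd u₋∈) u₋²)
            U≤ = U≤m+4 closed₁ triple us-odd {m} {U} 0≤m within {w} {W} (at-u₋ w≡) (at-u₊ W≡) 0≤w+U W₂≤U
        in classify closed₁ triple us-odd {m} {U} 0≤m within m≡ (at-most-5 {m} {U} m≡ U≤) {w} (at-u₋ w≡) t
        where
        at-most-5 : ∀ {m U} → m ≡ + 1 → 0ℤ ≤ᶻ m + + 4 - U → 0ℤ ≤ᶻ + 5 - U
        at-most-5 refl p = p
      equal-gaps : N ≡ + 2 * d₁ → d₂ ≡ d₁ → N ≡ + 4 × d₁ ≡ + 2 × d₂ ≡ + 2 × Classified us a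
      equal-gaps N≡2d d₂≡d₁ =
        let A , d≡2A = quarter N>0 coprime N≡2d closed₁ triples′ u₀∈
            N≡ = N≡4 N>0 coprime N≡2d closed₁ triples′ {A} d≡2A u₀∈
            d₁≡ = four N≡ N≡2d
            d₂≡ = trans d₂≡d₁ d₁≡
        in N≡ , d₁≡ , d₂≡ , final N≡ d₁≡ d₂≡
        where
        triples′ : ∀ {u w} → u ∈ us → N * w ≡ u * u + a → Triple us d₁ d₁ w
        triples′ {u} {w} u∈ w≡ = let w∈ , w₁∈ , w₂∈ = triple u∈ w≡ in w∈ , w₁∈ , subst (λ d → w + d₁ + d ∈ us) d₂≡d₁ w₂∈

-- The embedding of the integers into the rationals.

-- Opened only here: overloaded list constructors in scope would make the ring solver's variable lists ambiguous.
open import Data.List.Relation.Unary.All using ([]; _∷_)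
open import Data.List.Relation.Unary.AllPairs using (_∷_)
open import Data.List.Relation.Unary.Linked using (_∷_)

-- Built with the constructor instead of a division by 1, so that injectivity is a pattern match.
ι : ℤ → ℚ
ι i = mkℚ i 0 (ℕ.sym (1-coprimeTo ∣ i ∣))

ι-injective : ∀ {i j} → ι i ≡ ι j → i ≡ j
ι-injective refl = refl

ι-+ : ∀ i j → ι (i + j) ≡ ι i ℚ.+ ι j
ι-+ i j = ℚ.toℚᵘ-injective (ℚᵘ.≃-trans {j = ℚᵘ.mkℚᵘ i 0 ℚᵘ.+ ℚᵘ.mkℚᵘ j 0} (ℚᵘ.*≡* (numerators i j)) (ℚᵘ.≃-sym (ℚ.toℚᵘ-homo-+ (ι i) (ι j))))
  where
  numerators : ∀ i j → (i + j) * + 1 ≡ (i * + 1 + j * + 1) * + 1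
  numerators = solve-∀

ι-* : ∀ i j → ι (i * j) ≡ ι i ℚ.* ι j
ι-* i j = ℚ.toℚᵘ-injective (ℚᵘ.≃-trans {j = ℚᵘ.mkℚᵘ i 0 ℚᵘ.* ℚᵘ.mkℚᵘ j 0} (ℚᵘ.*≡* refl) (ℚᵘ.≃-sym (ℚ.toℚᵘ-homo-* (ι i) (ι j))))

ι-mono-≤ : ∀ {i j} → i ≤ᶻ j → ι i ℚ.≤ ι j
ι-mono-≤ {i} {j} i≤j = ℚ.*≤* (subst (λ z → z ≤ᶻ j * + 1) (sym (*-identityʳ i)) (subst (i ≤ᶻ_) (sym (*-identityʳ j)) i≤j))

ι-numerator : ∀ x → ι (↥ x) ≡ ι (↧ x) ℚ.* x
ι-numerator x@(mkℚ n d-1 _) = ℚ.toℚᵘ-injective (ℚᵘ.≃-trans {j = ℚᵘ.mkℚᵘ (+ suc d-1) 0 ℚᵘ.* ℚᵘ.mkℚᵘ n d-1}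
    (ℚᵘ.*≡* (trans (cong (λ d → n * + suc d) (ℕ.+-identityʳ d-1)) (swap n (+ suc d-1))))
    (ℚᵘ.≃-sym (ℚ.toℚᵘ-homo-* (ι (↧ x)) x)))
  where
  swap : ∀ n d → n * d ≡ d * n * + 1
  swap = solve-∀

divide : ∀ q r {x y} → q ℚ.* r ≡ 1ℚ → r ℚ.* x ≡ y → x ≡ q ℚ.* y
divide q r {x} qr≡1 refl = trans (sym (ℚ.*-identityˡ x)) (trans (cong (ℚ._* x) (sym qr≡1)) (ℚ.*-assoc q r x))

lcm-nonZero : ∀ m n .{{_ : NonZero m}} .{{_ : NonZero n}} → NonZero (lcm m n)
lcm-nonZero m n = ℕ.≢-nonZero λ lcm≡0 → ℕ.≢-nonZero⁻¹ (m ℕ.* n) {{ℕ.m*n≢0 m n}}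
  (trans (sym (gcd*lcm m n)) (trans (cong (ℕ.gcd m n ℕ.*_) lcm≡0) (ℕ.*-zeroʳ (ℕ.gcd m n))))
  where import Data.Nat.GCD as ℕ

-- Common denominators and scaling to integers.

Stable : List ℚ → ℚ → Set
Stable L c = ∀ {x} → x ∈ L → quad c x ∈ L

record CommonDenominator (L : List ℚ) : Set where
  field
    N : ℕ
    nonZero : NonZero N
    divisible : ∀ {x} → x ∈ L → ↧ₙ x ℕ.∣ N
    least : ∀ M → (∀ {x} → x ∈ L → ↧ₙ x ℕ.∣ M) → N ℕ.∣ M

commonDenominator : ∀ L → CommonDenominator L
commonDenominator [] = record { N = 1 ; nonZero = _ ; divisible = λ () ; least = λ M _ → ℕ.1∣ M }
commonDenominator (x ∷ L) = record
  { N = lcm (↧ₙ x) N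
  ; nonZero = lcm-nonZero (↧ₙ x) N {{_}} {{nonZero}}
  ; divisible = λ { (here refl) → m∣lcm[m,n] (↧ₙ x) N ; (there i) → ℕ.∣-trans (divisible i) (n∣lcm[m,n] (↧ₙ x) N) }
  ; least = λ M h → lcm-least (h (here refl)) (least M (λ i → h (there i)))
  }
  where open CommonDenominator (commonDenominator L)

prime-divisor : ∀ n .{{_ : NonTrivial n}} → ∃ λ p → Prime p × p ℕ.∣ n
prime-divisor n with factorise n {{ℕ.nonTrivial⇒nonZero n}}
... | record { factors = [] ; isFactorisation = n≡1 } = ⊥-elim (ℕ.nonTrivial⇒≢1 n≡1)
... | record { factors = p ∷ ps ; isFactorisation = refl ; factorsPrime = pp ∷ _ } = p , pp , ℕ.m∣m*n _

module _ {L : List ℚ} (D : CommonDenominator L) where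
  open CommonDenominator D

  private instance
    N-nonZero : NonZero N
    N-nonZero = nonZero

  -- This is `N x` for `x` in `L`, where the natural-number quotient is exact.
  scale : ℚ → ℤ
  scale x = ↥ x * + (N ℕ./ ↧ₙ x)

  cofactor : ∀ {x} → x ∈ L → N ℕ./ ↧ₙ x ℕ.* ↧ₙ x ≡ N
  cofactor x∈ = ℕ.m/n*n≡m (divisible x∈)

  ι-scale : ∀ {x} → x ∈ L → ι (scale x) ≡ ι (+ N) ℚ.* x
  ι-scale {x} x∈ = begin
    ι (↥ x * + q)                ≡⟨ ι-* (↥ x) (+ q) ⟩
    ι (↥ x) ℚ.* ι (+ q)          ≡⟨ cong (ℚ._* ι (+ q)) (ι-numerator x) ⟩
    ι (↧ x) ℚ.* x ℚ.* ι (+ q)    ≡⟨ ℚ.*-comm (ι (↧ x) ℚ.* x) (ι (+ q)) ⟩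
    ι (+ q) ℚ.* (ι (↧ x) ℚ.* x)  ≡⟨ sym (ℚ.*-assoc (ι (+ q)) (ι (↧ x)) x) ⟩
    ι (+ q) ℚ.* ι (↧ x) ℚ.* x    ≡⟨ cong (ℚ._* x) (sym (ι-* (+ q) (↧ x))) ⟩
    ι (+ q * ↧ x) ℚ.* x          ≡⟨ cong (λ z → ι z ℚ.* x) (trans (sym (pos-* q (↧ₙ x))) (cong +_ (cofactor x∈))) ⟩
    ι (+ N) ℚ.* x                ∎
    where
    open ≡-Reasoning
    q = N ℕ./ ↧ₙ x

  us : List ℤ
  us = map scale L

  -- A prime dividing N and every scaled point could be cancelled from the common denominator.
  no-common-prime : ∀ {p} → Prime p → p ℕ.∣ N → ¬ (∀ {x} → x ∈ L → p ℕ.∣ ∣ scale x ∣)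
  no-common-prime {p} pp (ℕ.divides M N≡M*p) p∣ = ℕ.<⇒≱ M<N (ℕ.∣⇒≤ (least M divides-M))
    where
    instance
      M-nonZero : NonZero M
      M-nonZero = ℕ.≢-nonZero λ { refl → ℕ.≢-nonZero⁻¹ N N≡M*p }
    M<N : M ℕ.< N
    M<N = subst (M ℕ.<_) (sym N≡M*p) (ℕ.m<m*n M p (ℕ.nonTrivial⇒n>1 p {{prime⇒nonTrivial pp}}))
    divides-M : ∀ {x} → x ∈ L → ↧ₙ x ℕ.∣ M
    divides-M {x} x∈ = let ℕ.divides k k≡ = p∣ x∈ in
      ℕ.coprime-divisor {o = M} (coprime-parts x) (ℕ.divides k (ℕ.*-cancelʳ-≡ _ _ p (shuffle k k≡)))
      where
      open ≡-Reasoning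
      instance
        p-nonZero : NonZero p
        p-nonZero = ℕ.nonTrivial⇒nonZero p {{prime⇒nonTrivial pp}}
      coprime-parts : ∀ x → Coprime (↧ₙ x) ∣ ↥ x ∣
      coprime-parts (mkℚ n d-1 c) = ℕ.sym (ℕ.recompute c)
      q = N ℕ./ ↧ₙ x
      shuffle : ∀ k → ∣ scale x ∣ ≡ k ℕ.* p → ∣ ↥ x ∣ ℕ.* M ℕ.* p ≡ k ℕ.* ↧ₙ x ℕ.* p
      shuffle k k≡ = begin
        ∣ ↥ x ∣ ℕ.* M ℕ.* p          ≡⟨ ℕ.*-assoc (∣ ↥ x ∣) M p ⟩
        ∣ ↥ x ∣ ℕ.* (M ℕ.* p)        ≡⟨ cong (∣ ↥ x ∣ ℕ.*_) (sym (trans (cofactor x∈) N≡M*p)) ⟩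
        ∣ ↥ x ∣ ℕ.* (q ℕ.* ↧ₙ x)     ≡⟨ sym (ℕ.*-assoc (∣ ↥ x ∣) q (↧ₙ x)) ⟩
        ∣ ↥ x ∣ ℕ.* q ℕ.* ↧ₙ x       ≡⟨ cong (ℕ._* ↧ₙ x) (trans (sym (abs-* (↥ x) (+ q))) k≡) ⟩
        k ℕ.* p ℕ.* ↧ₙ x             ≡⟨ ℕ.*-assoc k p (↧ₙ x) ⟩
        k ℕ.* (p ℕ.* ↧ₙ x)           ≡⟨ cong (k ℕ.*_) (ℕ.*-comm p (↧ₙ x)) ⟩
        k ℕ.* (↧ₙ x ℕ.* p)           ≡⟨ sym (ℕ.*-assoc k (↧ₙ x) p) ⟩
        k ℕ.* ↧ₙ x ℕ.* p             ∎

  scaled-image : ∀ {c x} → x ∈ L → quad c x ∈ L →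
    ι (+ N * scale (quad c x)) ≡ ι (scale x * scale x) ℚ.+ ι (+ N) ℚ.* ι (+ N) ℚ.* c
  scaled-image {c} {x} x∈ y∈ = begin
    ι (+ N * scale (quad c x))                       ≡⟨ ι-* (+ N) _ ⟩
    n ℚ.* ι (scale (quad c x))                       ≡⟨ cong (n ℚ.*_) (ι-scale y∈) ⟩
    n ℚ.* (n ℚ.* (x ℚ.* x ℚ.+ c))                    ≡⟨ expand n x c ⟩
    (n ℚ.* x) ℚ.* (n ℚ.* x) ℚ.+ n ℚ.* n ℚ.* c        ≡⟨ cong (λ z → z ℚ.* z ℚ.+ n ℚ.* n ℚ.* c) (sym (ι-scale x∈)) ⟩
    ι (scale x) ℚ.* ι (scale x) ℚ.+ n ℚ.* n ℚ.* c    ≡⟨ cong (ℚ._+ n ℚ.* n ℚ.* c) (sym (ι-* (scale x) (scale x))) ⟩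
    ι (scale x * scale x) ℚ.+ n ℚ.* n ℚ.* c          ∎
    where
    open ≡-Reasoning
    n = ι (+ N)
    expand : ∀ n x c → n ℚ.* (n ℚ.* (x ℚ.* x ℚ.+ c)) ≡ (n ℚ.* x) ℚ.* (n ℚ.* x) ℚ.+ n ℚ.* n ℚ.* c
    expand = ℚ.+-*-Solver.solve 3 (λ n x c → n :* (n :* (x :* x :+ c)) := (n :* x) :* (n :* x) :+ n :* n :* c) refl
      where open ℚ.+-*-Solver using (_:=_; _:+_; _:*_)

  module _ {P} (P∈ : P ∈ L) where

    -- The number `N² c`, read off from the value at `P` so that it is an integer by construction.
    offset : ℚ → ℤ
    offset c = + N * scale (quad c P) - scale P * scale P

    ι-offset : ∀ {c} → quad c P ∈ L → ι (offset c) ≡ ι (+ N) ℚ.* ι (+ N) ℚ.* c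
    ι-offset {c} y∈ = ∙-cancelˡ (ι (scale P * scale P)) _ _ (begin
      ι (scale P * scale P) ℚ.+ ι (offset c)                       ≡⟨ sym (ι-+ (scale P * scale P) (offset c)) ⟩
      ι (scale P * scale P + offset c)                             ≡⟨ cong ι (restore (scale P * scale P) (+ N * scale (quad c P))) ⟩
      ι (+ N * scale (quad c P))                                   ≡⟨ scaled-image P∈ y∈ ⟩
      ι (scale P * scale P) ℚ.+ ι (+ N) ℚ.* ι (+ N) ℚ.* c          ∎)
      where
      open ≡-Reasoning
      restore : ∀ s t → s + (t - s) ≡ t
      restore = solve-∀

    scaled-closed : ∀ {c} → Stable L c → (+ N , offset c) Closed us
    scaled-closed {c} stable u∈ with ∈-map⁻ scale u∈
    ... | x , x∈ , refl = scale (quad c x) , ∈-map⁺ scale (stable x∈) , ι-injective (begin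
      ι (+ N * scale (quad c x))                                   ≡⟨ scaled-image x∈ (stable x∈) ⟩
      ι (scale x * scale x) ℚ.+ ι (+ N) ℚ.* ι (+ N) ℚ.* c          ≡⟨ cong (ι (scale x * scale x) ℚ.+_) (sym (ι-offset (stable P∈))) ⟩
      ι (scale x * scale x) ℚ.+ ι (offset c)                       ≡⟨ sym (ι-+ (scale x * scale x) (offset c)) ⟩
      ι (scale x * scale x + offset c)                             ∎)
      where open ≡-Reasoning

    gap : ℚ → ℚ → ℤ
    gap c c′ = scale (quad c′ P) - scale (quad c P)

    offset-gap : ∀ c c′ → offset c′ ≡ offset c + + N * gap c c′
    offset-gap c c′ = identity (+ N) (scale P * scale P) (scale (quad c P)) (scale (quad c′ P))
      where
      identity : ∀ N s w w′ → N * w′ - s ≡ N * w - s + N * (w′ - w)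
      identity = solve-∀

    gap-positive : ∀ {c c′} → quad c P ∈ L → quad c′ P ∈ L → c ℚ.< c′ → 0ℤ ≤ᶻ gap c c′ - + 1
    gap-positive {c} {c′} y∈ y′∈ c<c′ = by
      (≱0 (scale (quad c P) - scale (quad c′ P)) λ p → ℚ.<-irrefl refl (ℚ.<-≤-trans strict (ι-mono-≤ (0≤i-j⇒j≤i p))))
      (flip (scale (quad c P)) (scale (quad c′ P)))
      where
      n-positive : ∀ n .{{_ : NonZero n}} → ℚ.Positive (ι (+ n))
      n-positive (suc n) = _
      strict : ι (scale (quad c P)) ℚ.< ι (scale (quad c′ P))
      strict = subst₂ ℚ._<_ (sym (ι-scale y∈)) (sym (ι-scale y′∈))
        (ℚ.*-monoʳ-<-pos (ι (+ N)) {{n-positive N}} (ℚ.+-monoʳ-< (P ℚ.* P) c<c′))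
      flip : ∀ w w′ → - (w - w′) - + 1 ≡ w′ - w - + 1
      flip = solve-∀

  module _ {a} (closed : (+ N , a) Closed us) where

    -- `N` divides `u² - v²`, so a prime dividing `N` and one point `u` divides every `v²`, hence
    -- every point.
    prime∤ : ∀ {p u} → Prime p → p ℕ.∣ N → u ∈ us → ¬ p ℕ.∣ ∣ u ∣
    prime∤ {p} {u} pp p∣N u∈ p∣u = no-common-prime pp p∣N λ x∈ → divides-value (∈-map⁺ scale x∈)
      where
      divides-value : ∀ {v} → v ∈ us → p ℕ.∣ ∣ v ∣
      divides-value {v} v∈ = [ (λ d → d) , (λ d → d) ]′ (euclidsLemma (∣ v ∣) (∣ v ∣) pp
          (subst (p ℕ.∣_) (abs-* v v) (∣⇒∣ᵤ p∣v²)))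
        where
        p∣v² : + p ∣ v * v
        p∣v² = subst (+ p ∣_) (cancel-square u v) (∣m∣n⇒∣m-n
          (∣m⇒∣m*n {+ p} {u} u (∣ᵤ⇒∣ p∣u))
          (∣-trans (∣ᵤ⇒∣ p∣N) (squareDifference-divisible {+ N} {a} {us} closed u∈ v∈)))
          where
          cancel-square : ∀ u v → u * u - (u * u - v * v) ≡ v * v
          cancel-square = solve-∀

    coprime : ∀ {u} → u ∈ us → ∀ {x} → + N ∣ u * x → + N ∣ x
    coprime {u} u∈ {x} h = ∣ᵤ⇒∣ (ℕ.coprime-divisor coprime-N (subst (N ℕ.∣_) (abs-* u x) (∣⇒∣ᵤ h)))
      where
      coprime-N : Coprime N ∣ u ∣
      coprime-N {0} (0∣N , _) = ⊥-elim (ℕ.≢-nonZero⁻¹ N (ℕ.0∣⇒≡0 0∣N))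
      coprime-N {1} _ = refl
      coprime-N {suc (suc i)} (i∣N , i∣u) =
        let p , pp , p∣i = prime-divisor (suc (suc i))
        in ⊥-elim (prime∤ pp (ℕ.∣-trans p∣i i∣N) u∈ (ℕ.∣-trans p∣i i∣u))

-- Return from integers to rational constants and points.

Exceptional : ℚ → ℚ → ℚ → ℚ → Set
Exceptional c₁ c₂ c₃ P =
    (c₁ ≡ ℚ.- (+ 21 ℚ./ 16) × c₂ ≡ ℚ.- (+ 13 ℚ./ 16) × c₃ ≡ ℚ.- (+ 5 ℚ./ 16) × P ∈ P₁)
  ⊎ (c₁ ≡ ℚ.- (+ 13 ℚ./ 16) × c₂ ≡ ℚ.- (+ 5 ℚ./ 16) × c₃ ≡ + 3 ℚ./ 16 × P ∈ P₂)

stable-classification : ∀ {L P c₁ c₂ c₃} → P ∈ L → c₁ ℚ.< c₂ → c₂ ℚ.< c₃ →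
  Stable L c₁ → Stable L c₂ → Stable L c₃ →
  Exceptional c₁ c₂ c₃ P
stable-classification {L} {P} {c₁} {c₂} {c₃} P∈ c₁<c₂ c₂<c₃ s₁ s₂ s₃ =
  let N≡4 , d₁≡2 , d₂≡2 , classified = integer-classification (positive N {{nonZero}}) (coprime D (scaled-closed D P∈ s₁))
        (gap-positive D P∈ (s₁ P∈) (s₂ P∈) c₁<c₂) (gap-positive D P∈ (s₂ P∈) (s₃ P∈) c₂<c₃)
        (scaled-closed D P∈ s₁)
        (subst (λ a → (+ N , a) Closed us D) offset₂ (scaled-closed D P∈ s₂))
        (subst (λ a → (+ N , a) Closed us D) offset₃ (scaled-closed D P∈ s₃))
        (∈-map⁺ (scale D) P∈)
  in conclude N≡4 d₁≡2 d₂≡2 classified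
  where
  D = commonDenominator L
  open CommonDenominator D
  positive : ∀ n .{{_ : NonZero n}} → 0ℤ ≤ᶻ + n - + 1
  positive (suc n) = 0≤+ n
  offset₂ : offset D P∈ c₂ ≡ offset D P∈ c₁ + + N * gap D P∈ c₁ c₂
  offset₂ = offset-gap D P∈ c₁ c₂
  offset₃ : offset D P∈ c₃ ≡ offset D P∈ c₁ + + N * gap D P∈ c₁ c₂ + + N * gap D P∈ c₂ c₃
  offset₃ = trans (offset-gap D P∈ c₂ c₃) (cong (λ a → a + + N * gap D P∈ c₂ c₃) offset₂)
  point : + N ≡ + 4 → ∀ {us} → scale D P ∈ us → P ∈ map (λ u → + 1 ℚ./ 4 ℚ.* ι u) us
  point N≡4 {us} i = subst (_∈ map (λ u → + 1 ℚ./ 4 ℚ.* ι u) us)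
    (sym (divide (+ 1 ℚ./ 4) (ι (+ 4)) refl (trans (cong (λ N → ι N ℚ.* P) (sym N≡4)) (sym (ι-scale D P∈)))))
    (∈-map⁺ _ i)
  coefficient : ∀ {c k} → + N ≡ + 4 → quad c P ∈ L → offset D P∈ c ≡ k → c ≡ + 1 ℚ./ 16 ℚ.* ι k
  coefficient {c} N≡4 y∈ refl = divide (+ 1 ℚ./ 16) (ι (+ 16)) refl
    (trans (cong (λ N → ι N ℚ.* ι N ℚ.* c) (sym N≡4)) (sym (ι-offset D P∈ y∈)))
  conclude : + N ≡ + 4 → gap D P∈ c₁ c₂ ≡ + 2 → gap D P∈ c₂ c₃ ≡ + 2 → Classified (us D) (offset D P∈ c₁) → Exceptional c₁ c₂ c₃ P
  -- Division by 4 turns `odd-up-to-5` and `odd-up-to-3` into `P₁` and `P₂` by computation, and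
  -- division by 16 does the same for the constants.
  conclude N≡4 d₁≡2 d₂≡2 classified = [ (λ (a≡ , points) → inj₁
        ( coefficient N≡4 (s₁ P∈) a≡ , coefficient N≡4 (s₂ P∈) (at₂ a≡) , coefficient N≡4 (s₃ P∈) (at₃ a≡)
        , point N≡4 (points (∈-map⁺ (scale D) P∈))))
      , (λ (a≡ , points) → inj₂
        ( coefficient N≡4 (s₁ P∈) a≡ , coefficient N≡4 (s₂ P∈) (at₂ a≡) , coefficient N≡4 (s₃ P∈) (at₃ a≡)
        , point N≡4 (points (∈-map⁺ (scale D) P∈)))) ]′ classified
    where
    -- Neighbouring offsets differ by `N` times the gap, which is `4 * 2 = 8`.
    at₂ : ∀ {k} → offset D P∈ c₁ ≡ k → offset D P∈ c₂ ≡ k + + 8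
    at₂ a≡ = trans offset₂ (cong₂ _+_ a≡ (cong₂ _*_ N≡4 d₁≡2))
    at₃ : ∀ {k} → offset D P∈ c₁ ≡ k → offset D P∈ c₃ ≡ k + + 8 + + 8
    at₃ a≡ = trans offset₃ (cong₂ _+_ (cong₂ _+_ a≡ (cong₂ _*_ N≡4 d₁≡2)) (cong₂ _*_ N≡4 d₂≡2))

-- From finite orbits to stable sets.

-- Points whose images leave the list are discarded until what remains is stable.
stable-part : ∀ cs (O : ℚ → Set) → (∀ {c x} → c ∈ cs → O x → O (quad c x)) →
  ∀ n L → length L ℕ.< n → (∀ {x} → O x → x ∈ L) → ∃ λ L′ → (∀ {c} → c ∈ cs → Stable L′ c) × (∀ {x} → O x → x ∈ L′)
stable-part cs O step (suc n) L bound O⊆L = prune (All.all? inside? L)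
  where
  inside? = λ x → All.all? (λ c → quad c x ∈? L) cs
  prune : Dec (All (λ x → All (λ c → quad c x ∈ L) cs) L) → ∃ λ L′ → (∀ {c} → c ∈ cs → Stable L′ c) × (∀ {x} → O x → x ∈ L′)
  prune (yes stable) = L , (λ c∈ x∈ → All.lookup (All.lookup stable x∈) c∈) , O⊆L
  prune (no ¬stable) = stable-part cs O step n (filter inside? L)
    (ℕ.<-≤-trans (filter-notAll inside? L (¬All⇒Any¬ inside? L ¬stable)) (ℕ.≤-pred bound))
    (λ o → ∈-filter⁺ inside? (O⊆L o) (All.tabulate λ c∈ → O⊆L (step c∈ o)))

-- Unlike `InOrbit` this admits the empty word, so that `P` itself lands in the stable set.
Reachable : List ℚ → ℚ → ℚ → Set
Reachable cs P x = ∃ λ w → All (_∈ cs) w × applyWord w P ≡ x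

applyWord-++ : ∀ w c P → applyWord (w ++ c ∷ []) P ≡ quad c (applyWord w P)
applyWord-++ [] c P = refl
applyWord-++ (b ∷ w) c P = applyWord-++ w c (quad b P)

finiteOrbit⇒stable : ∀ {cs P} → FiniteOrbit cs P → ∃ λ L → P ∈ L × (∀ {c} → c ∈ cs → Stable L c)
finiteOrbit⇒stable {cs} {P} (L , orbit⊆L) =
  let L′ , stable , reachable⊆ = stable-part cs (Reachable cs P) extend (suc (length (P ∷ L))) (P ∷ L) ℕ.≤-refl contained
  in L′ , reachable⊆ ([] , [] , refl) , stable
  where
  extend : ∀ {c x} → c ∈ cs → Reachable cs P x → Reachable cs P (quad c x)
  extend {c} c∈ (w , w⊆ , refl) = w ++ c ∷ [] , ++⁺ w⊆ (c∈ ∷ []) , applyWord-++ w c P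
  contained : ∀ {x} → Reachable cs P x → x ∈ P ∷ L
  contained ([] , _ , refl) = here refl
  contained (c ∷ w , w⊆ , refl) = there (orbit⊆L _ (c ∷ w , (λ ()) , w⊆ , refl))

-- Triples of constants and the two claims of the theorem.

exceptional : ∀ {cs P c₁ c₂ c₃} → FiniteOrbit cs P → c₁ ∈ cs → c₂ ∈ cs → c₃ ∈ cs → c₁ ℚ.< c₂ → c₂ ℚ.< c₃ → Exceptional c₁ c₂ c₃ P
exceptional orbit c₁∈ c₂∈ c₃∈ c₁<c₂ c₂<c₃ =
  let _ , P∈ , stable = finiteOrbit⇒stable orbit
  in stable-classification P∈ c₁<c₂ c₂<c₃ (stable c₁∈) (stable c₂∈) (stable c₃∈)

-- The smallest constant tells the two families apart and so determines the largest.
exceptional-unique : ∀ {c₁ c₂ c₃ d₂ d₃ P} → Exceptional c₁ c₂ c₃ P → Exceptional c₁ d₂ d₃ P → c₃ ≡ d₃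
exceptional-unique (inj₁ (_ , _ , e , _)) (inj₁ (_ , _ , f , _)) = trans e (sym f)
exceptional-unique (inj₂ (_ , _ , e , _)) (inj₂ (_ , _ , f , _)) = trans e (sym f)
exceptional-unique (inj₁ (refl , _)) (inj₂ (() , _))
exceptional-unique (inj₂ (refl , _)) (inj₁ (() , _))

reverse-∈ : ∀ {x y z c : ℚ} → c ∈ x ∷ y ∷ z ∷ [] → c ∈ z ∷ y ∷ x ∷ []
reverse-∈ (here e) = there (there (here e))
reverse-∈ (there (here e)) = there (here e)
reverse-∈ (there (there (here e))) = here e

exceptional-set : ∀ {c₁ c₂ c₃ P} → Exceptional c₁ c₂ c₃ P →
  (SameSet (c₁ ∷ c₂ ∷ c₃ ∷ []) S₁ × P ∈ P₁) ⊎ (SameSet (c₁ ∷ c₂ ∷ c₃ ∷ []) S₂ × P ∈ P₂)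
exceptional-set (inj₁ (refl , refl , refl , P∈)) = inj₁ ((λ _ → reverse-∈ , reverse-∈) , P∈)
exceptional-set (inj₂ (refl , refl , refl , P∈)) = inj₂ ((λ _ → reverse-∈ , reverse-∈) , P∈)

sameSet-resp-↭ : ∀ {A B C} → A ↭ B → SameSet A C → SameSet B C
sameSet-resp-↭ A↭B same c = (λ c∈ → proj₁ (same c) (∈-resp-↭ (↭-sym A↭B) c∈)) , (λ c∈ → ∈-resp-↭ A↭B (proj₂ (same c) c∈))

≤∧≢⇒< : ∀ {p q} → p ℚ.≤ q → p ≢ q → p ℚ.< q
≤∧≢⇒< p≤q p≢q = ℚ.≰⇒> λ q≤p → p≢q (ℚ.≤-antisym p≤q q≤p)

theorem1p1 : (cs : List ℚ) → Unique cs → 1 ≤ length cs → MuAtMost3 cs →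
    ((length cs ≡ 3 → ∀ (P : ℚ) → FiniteOrbit cs P →
    (SameSet cs S₁ × P ∈ P₁) ⊎ (SameSet cs S₂ × P ∈ P₂))
    × (4 ≤ length cs → ∀ (P : ℚ) → ¬ FiniteOrbit cs P))
theorem1p1 cs unique _ _ =
    (λ length≡3 P orbit → three (sort cs) (sort-↭ cs) unique-sorted (sort-↗ cs) (trans (↭-length (sort-↭ cs)) length≡3) orbit)
  , (λ length≥4 P orbit → four (sort cs) (sort-↭ cs) unique-sorted (sort-↗ cs) (subst (4 ≤_) (sym (↭-length (sort-↭ cs))) length≥4) orbit)
  where
  unique-sorted : Unique (sort cs)
  unique-sorted = Permutation.Unique-resp-↭ (setoid ℚ) (↭⇒↭ₛ (↭-sym (sort-↭ cs))) unique

  three : ∀ ds → ds ↭ cs → Unique ds → Sorted ds → length ds ≡ 3 → ∀ {P} → FiniteOrbit cs P →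
    (SameSet cs S₁ × P ∈ P₁) ⊎ (SameSet cs S₂ × P ∈ P₂)
  three (c₁ ∷ c₂ ∷ c₃ ∷ []) ds↭cs ((≢₁₂ ∷ _) ∷ (≢₂₃ ∷ _) ∷ _) (≤₁₂ ∷ ≤₂₃ ∷ _) refl orbit =
    [ (λ (same , P∈) → inj₁ (sameSet-resp-↭ ds↭cs same , P∈))
    , (λ (same , P∈) → inj₂ (sameSet-resp-↭ ds↭cs same , P∈)) ]′
    (exceptional-set (exceptional orbit (∈cs (here refl)) (∈cs (there (here refl))) (∈cs (there (there (here refl))))
      (≤∧≢⇒< ≤₁₂ ≢₁₂) (≤∧≢⇒< ≤₂₃ ≢₂₃)))
    where
    ∈cs : ∀ {c} → c ∈ c₁ ∷ c₂ ∷ c₃ ∷ [] → c ∈ cs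
    ∈cs = ∈-resp-↭ ds↭cs

  four : ∀ ds → ds ↭ cs → Unique ds → Sorted ds → 4 ≤ length ds → ∀ {P} → ¬ FiniteOrbit cs P
  four (_ ∷ []) _ _ _ (s≤s ())
  four (_ ∷ _ ∷ []) _ _ _ (s≤s (s≤s ()))
  four (_ ∷ _ ∷ _ ∷ []) _ _ _ (s≤s (s≤s (s≤s ())))
  four (c₁ ∷ c₂ ∷ c₃ ∷ c₄ ∷ ds) ds↭cs ((≢₁₂ ∷ _) ∷ (≢₂₃ ∷ _) ∷ (≢₃₄ ∷ _) ∷ _) (≤₁₂ ∷ ≤₂₃ ∷ ≤₃₄ ∷ _) _ orbit =
    -- The triples `c₁ c₂ c₃` and `c₁ c₂ c₄` share their smallest constant, which forces `c₃ ≡ c₄`.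
    ≢₃₄ (exceptional-unique
      (exceptional orbit (∈cs (here refl)) (∈cs (there (here refl))) (∈cs (there (there (here refl)))) <₁₂ <₂₃)
      (exceptional orbit (∈cs (here refl)) (∈cs (there (here refl))) (∈cs (there (there (there (here refl))))) <₁₂ (ℚ.<-≤-trans <₂₃ ≤₃₄)))
    where
    <₁₂ = ≤∧≢⇒< ≤₁₂ ≢₁₂
    <₂₃ = ≤∧≢⇒< ≤₂₃ ≢₂₃
    ∈cs : ∀ {c} → c ∈ c₁ ∷ c₂ ∷ c₃ ∷ c₄ ∷ ds → c ∈ cs
    ∈cs = ∈-resp-↭ ds↭cs
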